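{- Let $k$ be a positive integer, $V=[k]\times[k]$, terminals $t_i=(i,i)$, and $\gamma=2\lfloor 2k-\sqrt{3k^2-2k}\rfloor$. Let $f$ be the function on $2^V$ defined below with this $\gamma$. Call a partition $(A_1,\ldots,A_k)$ of $V$ with $t_\ell\in A_\ell$ for all $\ell$ an assignment, with cost $\sum_{\ell=1}^k f(A_\ell)$, and call it symmetric if $(i,j)$ and $(j,i)$ lie in the same part for all $i,j$. Then the ratio of the minimum cost of a symmetric assignment to the minimum cost of an assignment is at least $\frac{8\sqrt3-12}{2\sqrt3-2}-O(\frac1k)$.
   Context: Rows $R_i=\{(i,j):j\in[k]\}$, columns $C_i=\{(j,i):j\in[k]\}$. Define $\phi:\mathbb{R}\to\mathbb{R}$ by $\phi(t)=t$ if $t\le k-\gamma/2$ and $\phi(t)=2k-t-\gamma$ otherwise. For $i\in[k]$ and $S\subseteq V$ let $g_i(S)=\phi(|S|)$ if $t_i\notin S$ and $g_i(S)=\phi(k-|S|)$ if $t_i\in S$. Then $f(S)=\sum_{i=1}^k g_i(S\cap R_i)+\sum_{i=1}^k g_i(S\cap C_i)$. -}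

module Defs where

open import Data.Bool.Base using (Bool; true; false; _∧_; if_then_else_)
open import Data.Fin.Base using (Fin)
open import Data.Fin.Properties using () renaming (_≟_ to _≟ᶠ_)
open import Data.Integer.Base as ℤ using (ℤ; +_)
import Data.Integer.Properties as ℤₚ
open import Data.Nat.Base as ℕ using (ℕ; zero; suc)
import Data.Nat.Properties as ℕₚ
import Data.Nat.Solver as ℕ-Solver
open import Data.Product.Base using (Σ; ∃; ∃-syntax; _×_; _,_; proj₁; proj₂)
open import Data.Product using (∃!)
open import Data.Rational.Base as ℚ using (ℚ; 0ℚ; 1ℚ; ½; _/_; 1/_)
import Data.Rational.Properties as ℚₚ
import Data.Rational.Solver as ℚ-Solver
import Data.Rational.Unnormalised.Base as ℚᵘ
import Data.Rational.Unnormalised.Properties as ℚᵘₚ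
open import Data.Sum.Base using (inj₁; inj₂)
open import Relation.Binary.PropositionalEquality
open import Relation.Nullary using (yes; no; does; contradiction)

import Algebra.Properties.Monoid.Sum ℕₚ.+-0-monoid as Sumℕ
import Algebra.Properties.Monoid.Sum ℚₚ.+-0-monoid as Sumℚ

fromℕ : ℕ → ℚ
fromℕ n = + n / 1

fromℤ : ℤ → ℚ
fromℤ z = z / 1

-- Total inverse and division, with the convention 1/0 = 0.
inv : ℚ → ℚ
inv q with q ℚₚ.≟ 0ℚ
... | yes _   = 0ℚ
... | no  q≢0 = (1/ q) {{ℚ.≢-nonZero q≢0}}

infixl 7 _÷₀_
_÷₀_ : ℚ → ℚ → ℚ
p ÷₀ q = p ℚ.* inv q

private
  /-mono : ∀ a b m n .{{_ : ℕ.NonZero m}} .{{_ : ℕ.NonZero n}} →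
           a ℕ.* n ℕ.≤ b ℕ.* m → (+ a / m) ℚ.≤ (+ b / n)
  /-mono a b (suc m) (suc n) h = ℚₚ.toℚᵘ-cancel-≤
    (ℚᵘₚ.≤-trans (ℚᵘₚ.≤-reflexive (ℚₚ.toℚᵘ-fromℚᵘ (ℚᵘ.mkℚᵘ (+ a) m)))
    (ℚᵘₚ.≤-trans (ℚᵘ.*≤* (subst₂ ℤ._≤_ (ℤₚ.pos-* a (suc n)) (ℤₚ.pos-* b (suc m)) (ℤ.+≤+ h)))
                 (ℚᵘₚ.≤-reflexive (ℚᵘₚ.≃-sym (ℚₚ.toℚᵘ-fromℚᵘ (ℚᵘ.mkℚᵘ (+ b) n))))))

  /-+ : ∀ a b n .{{_ : ℕ.NonZero n}} → (+ (a ℕ.+ b) / n) ≡ (+ a / n) ℚ.+ (+ b / n)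
  /-+ a b (suc n) = ℚₚ.toℚᵘ-injective
    (ℚᵘₚ.≃-trans (ℚₚ.toℚᵘ-fromℚᵘ (ℚᵘ.mkℚᵘ (+ (a ℕ.+ b)) n))
    (ℚᵘₚ.≃-trans (ℚᵘ.*≡* eq)
    (ℚᵘₚ.≃-sym (ℚᵘₚ.≃-trans (ℚₚ.toℚᵘ-homo-+ (+ a / suc n) (+ b / suc n))
      (ℚᵘₚ.+-cong (ℚₚ.toℚᵘ-fromℚᵘ (ℚᵘ.mkℚᵘ (+ a) n)) (ℚₚ.toℚᵘ-fromℚᵘ (ℚᵘ.mkℚᵘ (+ b) n)))))))
    where
    d = + suc n
    eq : (+ (a ℕ.+ b)) ℤ.* (d ℤ.* d) ≡ ((+ a) ℤ.* d ℤ.+ (+ b) ℤ.* d) ℤ.* d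
    eq = trans (sym (ℤₚ.*-assoc (+ (a ℕ.+ b)) d d))
               (cong (ℤ._* d) (trans (cong (ℤ._* d) (ℤₚ.pos-+ a b)) (ℤₚ.*-distribʳ-+ d (+ a) (+ b))))

  ∣-∣≤ : ∀ {p e} → p ℚ.≤ e → ℚ.- p ℚ.≤ e → ℚ.∣ p ∣ ℚ.≤ e
  ∣-∣≤ {p} h h' with ℚₚ.∣p∣≡p∨∣p∣≡-p p
  ... | inj₁ eq = subst (ℚ._≤ _) (sym eq) h
  ... | inj₂ eq = subst (ℚ._≤ _) (sym eq) h'

  ≤∣∣ : ∀ p → p ℚ.≤ ℚ.∣ p ∣
  ≤∣∣ p with ℚₚ.≤-total 0ℚ p
  ... | inj₁ h = ℚₚ.≤-reflexive (sym (ℚₚ.0≤p⇒∣p∣≡p h))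
  ... | inj₂ h = ℚₚ.≤-trans h (ℚₚ.0≤∣p∣ p)

  *-mono : ∀ {p q r s} → 0ℚ ℚ.≤ q → 0ℚ ℚ.≤ r → p ℚ.≤ r → q ℚ.≤ s → p ℚ.* q ℚ.≤ r ℚ.* s
  *-mono {p} {q} {r} {s} 0≤q 0≤r h h' = ℚₚ.≤-trans
    (ℚₚ.*-monoʳ-≤-nonNeg q {{ℚ.nonNegative 0≤q}} h)
    (ℚₚ.*-monoˡ-≤-nonNeg r {{ℚ.nonNegative 0≤r}} h')

  shrink : ∀ B ε → 0ℚ ℚ.< B → 0ℚ ℚ.< ε → Σ ℚ λ δ → 0ℚ ℚ.< δ × δ ℚ.* B ≡ ε
  shrink B ε 0<B 0<ε = ε ℚ.* r , ℚₚ.positive⁻¹ _ {{ℚₚ.pos*pos⇒pos ε r}} ,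
    trans (ℚₚ.*-assoc ε r B) (trans (cong (ε ℚ.*_) (ℚₚ.*-inverseˡ B)) (ℚₚ.*-identityʳ ε))
    where
    instance
      _ = ℚ.positive 0<B
      _ = ℚ.positive 0<ε
      _ = ℚₚ.pos⇒nonZero B
      _ = ℚₚ.1/pos⇒pos B
    r = 1/ B

Cauchy : (ℕ → ℚ) → Set
Cauchy x = ∀ ε → 0ℚ ℚ.< ε →
  ∃[ N ] (∀ m n → N ℕ.≤ m → N ℕ.≤ n → ℚ.∣ x m ℚ.- x n ∣ ℚ.≤ ε)

-- Sequences are not quotiented: distinct representatives may denote the same real.
record ℝ : Set where
  constructor mkℝ
  field
    seq    : ℕ → ℚ
    cauchy : Cauchy seq
open ℝ public

infix 4 _≤ᴿ_ _<ᴿ_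

_≤ᴿ_ : ℝ → ℝ → Set
x ≤ᴿ y = ∀ ε → 0ℚ ℚ.< ε → ∃[ N ] (∀ n → N ℕ.≤ n → seq x n ℚ.≤ seq y n ℚ.+ ε)

_<ᴿ_ : ℝ → ℝ → Set
x <ᴿ y = ∃[ ε ] (0ℚ ℚ.< ε × ∃[ N ] (∀ n → N ℕ.≤ n → seq x n ℚ.+ ε ℚ.≤ seq y n))

-- Apartness from 0, the constructive form of being nonzero.
NonZeroᴿ : ℝ → Set
NonZeroᴿ x = ∃[ ε ] (0ℚ ℚ.< ε × ∃[ N ] (∀ n → N ℕ.≤ n → ε ℚ.≤ ℚ.∣ seq x n ∣))

ι : ℚ → ℝ
ι q = mkℝ (λ _ → q) λ ε 0<ε → 0 , λ _ _ _ _ →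
  subst (λ z → ℚ.∣ z ∣ ℚ.≤ ε) (sym (ℚₚ.+-inverseʳ q)) (ℚₚ.<⇒≤ 0<ε)

infixl 6 _+ᴿ_ _-ᴿ_
infixl 7 _*ᴿ_ _/ᴿ_
infix  8 -ᴿ_

private
  open ℚ-Solver.+-*-Solver

  ≤⊔ˡ : ∀ M N {n} → M ℕ.⊔ N ℕ.≤ n → M ℕ.≤ n
  ≤⊔ˡ M N = ℕₚ.≤-trans (ℕₚ.m≤m⊔n M N)
  ≤⊔ʳ : ∀ M N {n} → M ℕ.⊔ N ℕ.≤ n → N ℕ.≤ n
  ≤⊔ʳ M N = ℕₚ.≤-trans (ℕₚ.m≤n⊔m M N)

  two : ℚ
  two = 1ℚ ℚ.+ 1ℚ

  double : ∀ δ → δ ℚ.+ δ ≡ δ ℚ.* two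
  double = solve 1 (λ d → d :+ d := d :* con two) refl

  bound : ∀ x → Σ ℚ λ B → 0ℚ ℚ.< B × ∃[ N ] (∀ n → N ℕ.≤ n → ℚ.∣ seq x n ∣ ℚ.≤ B)
  bound x with cauchy x 1ℚ (ℚₚ.positive⁻¹ 1ℚ)
  ... | N , h = 1ℚ ℚ.+ ℚ.∣ seq x N ∣ , 0<B , N , λ n N≤n →
    subst (λ z → ℚ.∣ z ∣ ℚ.≤ 1ℚ ℚ.+ ℚ.∣ seq x N ∣) (split (seq x n) (seq x N))
      (ℚₚ.≤-trans (ℚₚ.∣p+q∣≤∣p∣+∣q∣ (seq x n ℚ.- seq x N) (seq x N))
                  (ℚₚ.+-monoˡ-≤ ℚ.∣ seq x N ∣ (h n N N≤n ℕₚ.≤-refl)))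
    where
    split : ∀ a b → a ℚ.- b ℚ.+ b ≡ a
    split = solve 2 (λ a b → a :+ (:- b) :+ b := a) refl
    0<B : 0ℚ ℚ.< 1ℚ ℚ.+ ℚ.∣ seq x N ∣
    0<B = ℚₚ.<-≤-trans (ℚₚ.positive⁻¹ 1ℚ)
      (subst (ℚ._≤ 1ℚ ℚ.+ ℚ.∣ seq x N ∣) (ℚₚ.+-identityʳ 1ℚ) (ℚₚ.+-monoʳ-≤ 1ℚ (ℚₚ.0≤∣p∣ (seq x N))))

_+ᴿ_ : ℝ → ℝ → ℝ
x +ᴿ y = mkℝ (λ n → seq x n ℚ.+ seq y n) λ ε 0<ε →
  let δ , 0<δ , eq = shrink two ε (ℚₚ.positive⁻¹ two) 0<ε
      M , hx = cauchy x δ 0<δ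
      N , hy = cauchy y δ 0<δ
  in M ℕ.⊔ N , λ m n p q → subst₂ (λ z e → ℚ.∣ z ∣ ℚ.≤ e)
       (swap (seq x m) (seq y m) (seq x n) (seq y n)) (trans (double δ) eq)
       (ℚₚ.≤-trans (ℚₚ.∣p+q∣≤∣p∣+∣q∣ (seq x m ℚ.- seq x n) (seq y m ℚ.- seq y n))
         (ℚₚ.+-mono-≤ (hx m n (≤⊔ˡ M N p) (≤⊔ˡ M N q)) (hy m n (≤⊔ʳ M N p) (≤⊔ʳ M N q))))
  where
  swap : ∀ a b c d → (a ℚ.- c) ℚ.+ (b ℚ.- d) ≡ (a ℚ.+ b) ℚ.- (c ℚ.+ d)
  swap = solve 4 (λ a b c d → (a :+ (:- c)) :+ (b :+ (:- d)) := (a :+ b) :+ (:- (c :+ d))) refl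

-ᴿ_ : ℝ → ℝ
-ᴿ x = mkℝ (λ n → ℚ.- seq x n) λ ε 0<ε →
  let N , h = cauchy x ε 0<ε
  in N , λ m n p q → subst (λ z → ℚ.∣ z ∣ ℚ.≤ ε) (swap (seq x m) (seq x n)) (h n m q p)
  where
  swap : ∀ a b → b ℚ.- a ≡ (ℚ.- a) ℚ.- (ℚ.- b)
  swap = solve 2 (λ a b → b :+ (:- a) := (:- a) :+ (:- (:- b))) refl

_-ᴿ_ : ℝ → ℝ → ℝ
x -ᴿ y = x +ᴿ (-ᴿ y)

_*ᴿ_ : ℝ → ℝ → ℝ
x *ᴿ y = mkℝ (λ n → seq x n ℚ.* seq y n) λ ε 0<ε →
  let Bx , 0<Bx , Nx , bx = bound x
      By , 0<By , Ny , by = bound y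
      0<B = ℚₚ.+-mono-< 0<Bx 0<By
      δ , 0<δ , eq = shrink (Bx ℚ.+ By) ε 0<B 0<ε
      M , hx = cauchy x δ 0<δ
      N , hy = cauchy y δ 0<δ
      K = (Nx ℕ.⊔ Ny) ℕ.⊔ (M ℕ.⊔ N)
  in K , λ m n p q →
    let xm = seq x m; xn = seq x n; ym = seq y m; yn = seq y n
        p₁ = ≤⊔ˡ (Nx ℕ.⊔ Ny) (M ℕ.⊔ N) p
        p₂ = ≤⊔ʳ (Nx ℕ.⊔ Ny) (M ℕ.⊔ N) p
        q₁ = ≤⊔ˡ (Nx ℕ.⊔ Ny) (M ℕ.⊔ N) q
        q₂ = ≤⊔ʳ (Nx ℕ.⊔ Ny) (M ℕ.⊔ N) q
    in subst₂ (λ z e → ℚ.∣ z ∣ ℚ.≤ e) (swap xm xn ym yn) (trans (fact δ Bx By) eq)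
       (ℚₚ.≤-trans (ℚₚ.∣p+q∣≤∣p∣+∣q∣ (xm ℚ.* (ym ℚ.- yn)) (yn ℚ.* (xm ℚ.- xn)))
         (ℚₚ.+-mono-≤
           (est xm (ym ℚ.- yn) 0<Bx (bx m (≤⊔ˡ Nx Ny p₁)) (hy m n (≤⊔ʳ M N p₂) (≤⊔ʳ M N q₂)))
           (est yn (xm ℚ.- xn) 0<By (by n (≤⊔ʳ Nx Ny q₁)) (hx m n (≤⊔ˡ M N p₂) (≤⊔ˡ M N q₂)))))
  where
  swap : ∀ a b c d → a ℚ.* (c ℚ.- d) ℚ.+ d ℚ.* (a ℚ.- b) ≡ a ℚ.* c ℚ.- b ℚ.* d
  swap = solve 4 (λ a b c d → a :* (c :+ (:- d)) :+ d :* (a :+ (:- b)) := a :* c :+ (:- (b :* d))) refl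
  fact : ∀ d a b → a ℚ.* d ℚ.+ b ℚ.* d ≡ d ℚ.* (a ℚ.+ b)
  fact = solve 3 (λ d a b → a :* d :+ b :* d := d :* (a :+ b)) refl
  est : ∀ p q {B δ} → 0ℚ ℚ.< B → ℚ.∣ p ∣ ℚ.≤ B → ℚ.∣ q ∣ ℚ.≤ δ → ℚ.∣ p ℚ.* q ∣ ℚ.≤ B ℚ.* δ
  est p q 0<B h h' = subst (ℚ._≤ _) (sym (ℚₚ.∣p*q∣≡∣p∣*∣q∣ p q))
    (*-mono (ℚₚ.0≤∣p∣ q) (ℚₚ.<⇒≤ 0<B) h h')

inv-cancel : ∀ {q} → q ≢ 0ℚ → inv q ℚ.* q ≡ 1ℚ
inv-cancel {q} q≢0 with q ℚₚ.≟ 0ℚ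
... | yes q≡0  = contradiction q≡0 q≢0
... | no  q≢0' = ℚₚ.*-inverseˡ q {{ℚ.≢-nonZero q≢0'}}

private
  away : ∀ {ε p} → 0ℚ ℚ.< ε → ε ℚ.≤ ℚ.∣ p ∣ → p ≢ 0ℚ
  away 0<ε h refl = ℚₚ.<-irrefl refl (ℚₚ.<-≤-trans 0<ε h)

  inv-Cauchy : ∀ x → NonZeroᴿ x → Cauchy (λ n → inv (seq x n))
  inv-Cauchy x (η , 0<η , M , hη) ε 0<ε = M ℕ.⊔ N , main
    where
    instance
      _ = ℚ.positive 0<η
      _ = ℚ.positive 0<ε
      _ = ℚₚ.pos*pos⇒pos η η
      _ = ℚₚ.pos*pos⇒pos ε (η ℚ.* η)
    0<δ = ℚₚ.positive⁻¹ (ε ℚ.* (η ℚ.* η))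
    N = proj₁ (cauchy x _ 0<δ)
    h = proj₂ (cauchy x _ 0<δ)

    alg : ∀ a b u v → (u ℚ.- v) ℚ.* (a ℚ.* b) ≡ (u ℚ.* a) ℚ.* b ℚ.- (v ℚ.* b) ℚ.* a
    alg = solve 4 (λ a b u v → (u :+ (:- v)) :* (a :* b) := (u :* a) :* b :+ (:- ((v :* b) :* a))) refl

    main : ∀ m n → M ℕ.⊔ N ℕ.≤ m → M ℕ.⊔ N ℕ.≤ n →
           ℚ.∣ inv (seq x m) ℚ.- inv (seq x n) ∣ ℚ.≤ ε
    main m n p q = ℚₚ.*-cancelʳ-≤-pos ∣ab∣ {{ℚ.positive 0<∣ab∣}} le
      where
      a = seq x m
      b = seq x n
      d = inv a ℚ.- inv b
      ∣ab∣ = ℚ.∣ a ℚ.* b ∣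
      ha = hη m (≤⊔ˡ M N p)
      hb = hη n (≤⊔ˡ M N q)
      ηη≤ : η ℚ.* η ℚ.≤ ∣ab∣
      ηη≤ = subst (η ℚ.* η ℚ.≤_) (sym (ℚₚ.∣p*q∣≡∣p∣*∣q∣ a b))
              (*-mono (ℚₚ.<⇒≤ 0<η) (ℚₚ.0≤∣p∣ a) ha hb)
      0<∣ab∣ : 0ℚ ℚ.< ∣ab∣
      0<∣ab∣ = ℚₚ.<-≤-trans (ℚₚ.positive⁻¹ (η ℚ.* η)) ηη≤
      d*ab : d ℚ.* (a ℚ.* b) ≡ b ℚ.- a
      d*ab = trans (alg a b (inv a) (inv b)) (cong₂ ℚ._-_
        (trans (cong (ℚ._* b) (inv-cancel (away 0<η ha))) (ℚₚ.*-identityˡ b))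
        (trans (cong (ℚ._* a) (inv-cancel (away 0<η hb))) (ℚₚ.*-identityˡ a)))
      le : ℚ.∣ d ∣ ℚ.* ∣ab∣ ℚ.≤ ε ℚ.* ∣ab∣
      le = ℚₚ.≤-trans
        (ℚₚ.≤-reflexive (trans (sym (ℚₚ.∣p*q∣≡∣p∣*∣q∣ d (a ℚ.* b))) (cong ℚ.∣_∣ d*ab)))
        (ℚₚ.≤-trans (h n m (≤⊔ʳ M N q) (≤⊔ʳ M N p))
          (ℚₚ.*-monoˡ-≤-nonNeg ε {{ℚₚ.pos⇒nonNeg ε}} ηη≤))

_/ᴿ_ : (x y : ℝ) {{_ : NonZeroᴿ y}} → ℝ
_/ᴿ_ x y {{y≢0}} = x *ᴿ mkℝ (λ n → inv (seq y n)) (inv-Cauchy y y≢0)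

IsFloor : ℝ → ℤ → Set
IsFloor x z = (ι (fromℤ z) ≤ᴿ x) × (x <ᴿ ι (fromℤ (z ℤ.+ ℤ.1ℤ)))

private
  step : ℕ → ℕ → ℕ
  step n r with suc r ℕ.* suc r ℕₚ.≤? n
  ... | yes _ = suc r
  ... | no  _ = r

isqrt : ℕ → ℕ
isqrt zero    = 0
isqrt (suc n) = step (suc n) (isqrt n)

private
  step-lower : ∀ n r → r ℕ.* r ℕ.≤ n → step (suc n) r ℕ.* step (suc n) r ℕ.≤ suc n
  step-lower n r ih with suc r ℕ.* suc r ℕₚ.≤? suc n
  ... | yes h = h
  ... | no  _ = ℕₚ.m≤n⇒m≤1+n ih

  step-upper : ∀ n r → n ℕ.< suc r ℕ.* suc r →
               suc n ℕ.< suc (step (suc n) r) ℕ.* suc (step (suc n) r)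
  step-upper n r ih with suc r ℕ.* suc r ℕₚ.≤? suc n
  ... | yes _ = ℕₚ.≤-<-trans ih (ℕₚ.*-mono-< (ℕₚ.n<1+n (suc r)) (ℕₚ.n<1+n (suc r)))
  ... | no  h = ℕₚ.≰⇒> h

isqrt-lower : ∀ n → isqrt n ℕ.* isqrt n ℕ.≤ n
isqrt-lower zero    = ℕ.z≤n
isqrt-lower (suc n) = step-lower n (isqrt n) (isqrt-lower n)

isqrt-upper : ∀ n → n ℕ.< suc (isqrt n) ℕ.* suc (isqrt n)
isqrt-upper zero    = ℕ.s≤s ℕ.z≤n
isqrt-upper (suc n) = step-upper n (isqrt n) (isqrt-upper n)

-- ⌊√(n m²)⌋ / m with m = j + 1, which is within 1/m of √n.
√-seq : ℕ → ℕ → ℚ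
√-seq n j = + isqrt (n ℕ.* (suc j ℕ.* suc j)) / suc j

open ℕ-Solver.+-*-Solver using () renaming (solve to solveℕ; _:*_ to _⊛_; _:=_ to _⊜_)

√-close : ∀ n i j → √-seq n i ℚ.≤ √-seq n j ℚ.+ (+ 1 / suc j)
√-close n i j = subst (√-seq n i ℚ.≤_) (/-+ b 1 L)
  (/-mono a (b ℕ.+ 1) M L (subst (λ z → a ℕ.* L ℕ.≤ z ℕ.* M) (ℕₚ.+-comm 1 b) aL≤))
  where
  M = suc i
  L = suc j
  a = isqrt (n ℕ.* (M ℕ.* M))
  b = isqrt (n ℕ.* (L ℕ.* L))
  sq : ∀ x y → (x ℕ.* x) ℕ.* (y ℕ.* y) ≡ (x ℕ.* y) ℕ.* (x ℕ.* y)
  sq = solveℕ 2 (λ x y → (x ⊛ x) ⊛ (y ⊛ y) ⊜ (x ⊛ y) ⊛ (x ⊛ y)) refl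
  sw : ∀ n x y → n ℕ.* (x ℕ.* x) ℕ.* (y ℕ.* y) ≡ n ℕ.* (y ℕ.* y) ℕ.* (x ℕ.* x)
  sw = solveℕ 3 (λ n x y → n ⊛ (x ⊛ x) ⊛ (y ⊛ y) ⊜ n ⊛ (y ⊛ y) ⊛ (x ⊛ x)) refl
  sqle : (a ℕ.* L) ℕ.* (a ℕ.* L) ℕ.≤ (suc b ℕ.* M) ℕ.* (suc b ℕ.* M)
  sqle = subst₂ ℕ._≤_ (sq a L) (sq (suc b) M)
    (ℕₚ.≤-trans (ℕₚ.*-monoˡ-≤ (L ℕ.* L) (isqrt-lower (n ℕ.* (M ℕ.* M))))
    (ℕₚ.≤-trans (ℕₚ.≤-reflexive (sw n M L))
      (ℕₚ.*-monoˡ-≤ (M ℕ.* M) (ℕₚ.<⇒≤ (isqrt-upper (n ℕ.* (L ℕ.* L)))))))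
  aL≤ : a ℕ.* L ℕ.≤ suc b ℕ.* M
  aL≤ with a ℕ.* L ℕₚ.≤? suc b ℕ.* M
  ... | yes h = h
  ... | no  h = contradiction sqle (ℕₚ.<⇒≱ (ℕₚ.*-mono-< (ℕₚ.≰⇒> h) (ℕₚ.≰⇒> h)))

private
  small : ∀ ε → 0ℚ ℚ.< ε → ∃[ N ] (∀ n → N ℕ.≤ n → (+ 1 / suc n) ℚ.≤ ε)
  small (ℚ.mkℚ (+ suc p) d c) _ = d , λ n d≤n →
    subst ((+ 1 / suc n) ℚ.≤_) (ℚₚ.↥p/↧p≡p (ℚ.mkℚ (+ suc p) d c))
      (/-mono 1 (suc p) (suc n) (suc d)
        (subst (ℕ._≤ suc p ℕ.* suc n) (sym (ℕₚ.*-identityˡ (suc d)))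
          (ℕₚ.≤-trans (ℕ.s≤s d≤n) (ℕₚ.m≤m+n (suc n) (p ℕ.* suc n)))))
  small (ℚ.mkℚ (+ zero) d c) (ℚ.*<* (ℤ.+<+ ()))
  small (ℚ.mkℚ ℤ.-[1+ _ ] d c) (ℚ.*<* ())

  diff≤ : ∀ {p q e} → p ℚ.≤ q ℚ.+ e → p ℚ.- q ℚ.≤ e
  diff≤ {p} {q} {e} h = subst (p ℚ.- q ℚ.≤_) (alg q e) (ℚₚ.+-monoˡ-≤ (ℚ.- q) h)
    where
    alg : ∀ q e → q ℚ.+ e ℚ.- q ≡ e
    alg = solve 2 (λ q e → q :+ e :+ (:- q) := e) refl

√ : ℕ → ℝ
√ n = mkℝ (√-seq n) λ ε 0<ε → let N , h = small ε 0<ε in N , λ i j p q →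
  ∣-∣≤ (ℚₚ.≤-trans (diff≤ (√-close n i j)) (h j q))
       (subst (ℚ._≤ ε) (neg (√-seq n j) (√-seq n i)) (ℚₚ.≤-trans (diff≤ (√-close n j i)) (h i p)))
  where
  neg : ∀ a b → a ℚ.- b ≡ ℚ.- (b ℚ.- a)
  neg = solve 2 (λ a b → a :+ (:- b) := :- (b :+ (:- a))) refl

ιℕ : ℕ → ℝ
ιℕ n = ι (fromℕ n)

instance
  2√3-2≢0 : NonZeroᴿ (ιℕ 2 *ᴿ √ 3 -ᴿ ιℕ 2)
  2√3-2≢0 = ½ , ℚₚ.positive⁻¹ ½ , 3 , λ j 3≤j →
    ℚₚ.≤-trans (bnd j 3≤j) (≤∣∣ (fromℕ 2 ℚ.* √-seq 3 j ℚ.- fromℕ 2))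
    where
    -- √-seq 3 3 = 6/4, and later terms are at least 6/4 - 1/4.
    bnd : ∀ j → 3 ℕ.≤ j → ½ ℚ.≤ fromℕ 2 ℚ.* √-seq 3 j ℚ.- fromℕ 2
    bnd j 3≤j = ℚₚ.+-monoˡ-≤ (ℚ.- fromℕ 2) (ℚₚ.*-monoˡ-≤-nonNeg (fromℕ 2) {5/4} 5/4≤)
      where
      5/4 = + 5 / 4
      1/4 = + 1 / 4
      5/4≤ : 5/4 ℚ.≤ √-seq 3 j
      5/4≤ = subst (5/4 ℚ.≤_) (alg (√-seq 3 j))
        (ℚₚ.+-monoˡ-≤ (ℚ.- 1/4) (ℚₚ.≤-trans (√-close 3 3 j)
          (ℚₚ.+-monoʳ-≤ (√-seq 3 j) (/-mono 1 1 (suc j) 4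
            (subst (4 ℕ.≤_) (sym (ℕₚ.*-identityˡ (suc j))) (ℕ.s≤s 3≤j))))))
        where
        alg : ∀ s → s ℚ.+ 1/4 ℚ.- 1/4 ≡ s
        alg = solve 1 (λ s → s :+ con 1/4 :+ (:- con 1/4) := s) refl

module _ (k : ℕ) where

  V : Set
  V = Fin k × Fin k

  Subset : Set
  Subset = V → Bool

module _ {k : ℕ} where

  infix 4 _∈_
  infixl 7 _∩_

  _∈_ : V k → Subset k → Set
  v ∈ S = S v ≡ true

  _∩_ : Subset k → Subset k → Subset k
  (S ∩ T) v = S v ∧ T v

  card : Subset k → ℕ
  card S = Sumℕ.sum λ i → Sumℕ.sum λ j → if S (i , j) then 1 else 0

  row : Fin k → Subset k
  row i (a , _) = does (a ≟ᶠ i)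

  column : Fin k → Subset k
  column i (_ , b) = does (b ≟ᶠ i)

  terminal : Fin k → V k
  terminal i = i , i

-- φ is only ever evaluated at integers, so it is given on ℚ instead of ℝ,
-- where the case distinction is decidable.
φ : ℕ → ℚ → ℚ → ℚ
φ k γ t = if t ℚ.≤ᵇ (fromℕ k ℚ.- γ ℚ.* ½)
          then t
          else fromℕ 2 ℚ.* fromℕ k ℚ.- t ℚ.- γ

module _ {k : ℕ} (γ : ℚ) where

  g : Fin k → Subset k → ℚ
  g i S = if S (terminal i)
          then φ k γ (fromℕ k ℚ.- fromℕ (card S))
          else φ k γ (fromℕ (card S))

  f : Subset k → ℚ
  f S = Sumℚ.sum (λ i → g i (S ∩ row i)) ℚ.+ Sumℚ.sum (λ i → g i (S ∩ column i))

-- The parts are automatically nonempty, as each contains its terminal.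
record Assignment (k : ℕ) : Set where
  field
    part      : Fin k → Subset k
    partition : ∀ v → ∃! _≡_ (λ ℓ → v ∈ part ℓ)
    terminals : ∀ ℓ → terminal ℓ ∈ part ℓ
open Assignment public

cost : ∀ {k} → ℚ → Assignment k → ℚ
cost γ A = Sumℚ.sum λ ℓ → f γ (part A ℓ)

Symmetric : ∀ {k} → Assignment k → Set
Symmetric A = ∀ i j → ∃[ ℓ ] ((i , j) ∈ part A ℓ × (j , i) ∈ part A ℓ)

IsMinimum : {A : Set} → (A → Set) → (A → ℚ) → ℚ → Set
IsMinimum P c m = (∃[ a ] (P a × c a ≡ m)) × (∀ a → P a → m ℚ.≤ c a)

{-# OPTIONS --safe #-}

-- With γ = 2h and E = 2(k − h), φ(t) = min(t, E − t).  A row or column i costs at least E, except for a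
-- saving of 2(a − h) if a > h of its cells lie in part i, or of 2(b − (k − h)) if b > k − h of its cells
-- lie in a single other part.  In a symmetric assignment rows and columns cost the same, and a cell
-- (i, j) with i ≠ j cannot serve both line i through part i and line j through part j.  If p lines save
-- through their own part and q through another one, counting cells in pairs (i, j), (j, i) bounds the
-- savings by 2p(k − q) − p² + 2h(q − p) + O(k) ≤ max(2kh, (k − h)²) + O(k), and the choice of h makes both
-- terms of the maximum 2(2 − √3)k² + O(k).  On the other side the assignment into rows costs at most
-- 2k(k − h).  The limiting ratio simplifies to 3 − √3, and every lower approximation s of √3 satisfies
-- (8s − 12)/(2s − 2) ≤ 3 − √3, so that no limit has to be taken.
module Submission where

open import Algebra.Bundles using (CommutativeRing)
import Algebra.Properties.Monoid.Sum as MonoidSum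
import Algebra.Properties.Semiring.Sum as SemiringSum
open import Data.Bool.Base using (Bool; true; false; if_then_else_; _∧_; T)
open import Data.Bool.Properties using (∧-identityʳ)
open import Data.Fin.Base using (Fin; zero; suc)
open import Data.Fin.Patterns using (0F; 1F)
open import Data.Fin.Properties using () renaming (_≟_ to _≟ᶠ_; any? to anyᶠ?)
open import Data.Integer.Base as ℤ using (ℤ; +_)
import Data.Integer.Properties as ℤₚ
open import Data.Maybe.Base using (Maybe; just; nothing)
open import Data.Nat.Base as ℕ using (ℕ; zero; suc)
import Data.Nat.Properties as ℕₚ
open import Data.Nat.Tactic.RingSolver using () renaming (solve-∀ to solveℕ-∀)
open import Data.Product.Base using (∃-syntax; _×_; _,_; proj₁; proj₂)
open import Data.Rational.Base as ℚ using (ℚ; 0ℚ; 1ℚ; ½; _/_; _+_; _*_; _-_; -_; _≤_; _<_; _⊓_)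
import Data.Rational.Properties as ℚₚ
import Data.Rational.Unnormalised.Base as ℚᵘ
import Data.Rational.Unnormalised.Properties as ℚᵘₚ
open import Data.Sum.Base using (_⊎_; inj₁; inj₂; [_,_]′) renaming (map to ⊎-map)
open import Data.Unit.Base using (⊤; tt)
open import Function.Base using (_∘_)
open import Level using (0ℓ)
open import Relation.Binary.PropositionalEquality
open import Relation.Nullary using (¬_; Dec; yes; no; does; contradiction; _×-dec_; ¬?)
open import Relation.Nullary.Decidable using (dec-true; dec-false)
open import Tactic.RingSolver using (solve-∀)
open import Tactic.RingSolver.Core.AlmostCommutativeRing using (AlmostCommutativeRing; fromCommutativeRing)
open import Defs

open SemiringSum (CommutativeRing.semiring ℚₚ.+-*-commutativeRing)
  using (∑-distrib-+; ∑-comm; *-distribˡ-sum; *-distribʳ-sum; sum-cong-≗) renaming (sum to ∑)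
open MonoidSum ℕₚ.+-0-monoid using () renaming (sum to ∑ℕ)

ringℚ : AlmostCommutativeRing 0ℓ 0ℓ
ringℚ = fromCommutativeRing ℚₚ.+-*-commutativeRing isZero
  where
  isZero : ∀ x → Maybe (0ℚ ≡ x)
  isZero x with 0ℚ ℚₚ.≟ x
  ... | yes eq = just eq
  ... | no  _  = nothing

-- Ordered-field arithmetic

≤⇒0≤- : ∀ {a b} → a ≤ b → 0ℚ ≤ b - a
≤⇒0≤- {a} {b} a≤b = subst (_≤ b - a) (ℚₚ.+-inverseʳ a) (ℚₚ.+-monoˡ-≤ (- a) a≤b)

0≤+ : ∀ {a b} → 0ℚ ≤ a → 0ℚ ≤ b → 0ℚ ≤ a + b
0≤+ = ℚₚ.+-mono-≤

0≤* : ∀ {a b} → 0ℚ ≤ a → 0ℚ ≤ b → 0ℚ ≤ a * b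
0≤* {a} {b} 0≤a 0≤b = subst (_≤ a * b) (ℚₚ.*-zeroʳ a) (ℚₚ.*-monoˡ-≤-nonNeg a {{ℚ.nonNegative 0≤a}} 0≤b)

-- The form of nearly every inequality below: `c` is a certificate assembled from nonnegative
-- pieces, and the ring solver checks that it equals the difference of the two sides.
≤-by : ∀ {a b c} → 0ℚ ≤ c → c ≡ b - a → a ≤ b
≤-by {a} {b} 0≤c eq = subst₂ _≤_ (ℚₚ.+-identityˡ a) (cancel b a)
  (ℚₚ.+-monoˡ-≤ a (subst (0ℚ ≤_) eq 0≤c))
  where
  cancel : ∀ x y → x - y + y ≡ x
  cancel = solve-∀ ringℚ

<⇒≱ : ∀ {a b} → a < b → ¬ b ≤ a
<⇒≱ a<b b≤a = ℚₚ.<-irrefl refl (ℚₚ.<-≤-trans a<b b≤a)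

0≤1 : 0ℚ ≤ 1ℚ
0≤1 = ℚₚ.<⇒≤ (ℚₚ.positive⁻¹ 1ℚ)

0≤square : ∀ x → 0ℚ ≤ x * x
0≤square x with ℚₚ.≤-total 0ℚ x
... | inj₁ 0≤x = 0≤* 0≤x 0≤x
... | inj₂ x≤0 = subst (0ℚ ≤_) (alg x) (0≤* (≤⇒0≤- x≤0) (≤⇒0≤- x≤0))
  where
  alg : ∀ x → (0ℚ - x) * (0ℚ - x) ≡ x * x
  alg = solve-∀ ringℚ

fromℤ-+ : ∀ a b → fromℤ (a ℤ.+ b) ≡ fromℤ a + fromℤ b
fromℤ-+ a b = ℚₚ.toℚᵘ-injective
  (ℚᵘₚ.≃-trans (ℚₚ.toℚᵘ-fromℚᵘ (ℚᵘ.mkℚᵘ (a ℤ.+ b) 0))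
  (ℚᵘₚ.≃-trans (ℚᵘ.*≡* (cong (ℤ._* + 1) (sym (cong₂ ℤ._+_ (ℤₚ.*-identityʳ a) (ℤₚ.*-identityʳ b)))))
  (ℚᵘₚ.≃-sym (ℚᵘₚ.≃-trans (ℚₚ.toℚᵘ-homo-+ (fromℤ a) (fromℤ b))
    (ℚᵘₚ.+-cong (ℚₚ.toℚᵘ-fromℚᵘ (ℚᵘ.mkℚᵘ a 0)) (ℚₚ.toℚᵘ-fromℚᵘ (ℚᵘ.mkℚᵘ b 0)))))))

fromℤ-* : ∀ a b → fromℤ (a ℤ.* b) ≡ fromℤ a * fromℤ b
fromℤ-* a b = ℚₚ.toℚᵘ-injective
  (ℚᵘₚ.≃-trans (ℚₚ.toℚᵘ-fromℚᵘ (ℚᵘ.mkℚᵘ (a ℤ.* b) 0))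
  (ℚᵘₚ.≃-sym (ℚᵘₚ.≃-trans (ℚₚ.toℚᵘ-homo-* (fromℤ a) (fromℤ b))
    (ℚᵘₚ.*-cong (ℚₚ.toℚᵘ-fromℚᵘ (ℚᵘ.mkℚᵘ a 0)) (ℚₚ.toℚᵘ-fromℚᵘ (ℚᵘ.mkℚᵘ b 0))))))

fromℤ-mono : ∀ {a b} → a ℤ.≤ b → fromℤ a ≤ fromℤ b
fromℤ-mono {a} {b} a≤b = ℚₚ.toℚᵘ-cancel-≤
  (ℚᵘₚ.≤-trans (ℚᵘₚ.≤-reflexive (ℚₚ.toℚᵘ-fromℚᵘ (ℚᵘ.mkℚᵘ a 0)))
  (ℚᵘₚ.≤-trans (ℚᵘ.*≤* (ℤₚ.*-monoʳ-≤-nonNeg (+ 1) a≤b))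
    (ℚᵘₚ.≤-reflexive (ℚᵘₚ.≃-sym (ℚₚ.toℚᵘ-fromℚᵘ (ℚᵘ.mkℚᵘ b 0))))))

fromℕ-+ : ∀ m n → fromℕ (m ℕ.+ n) ≡ fromℕ m + fromℕ n
fromℕ-+ m n = trans (cong fromℤ (ℤₚ.pos-+ m n)) (fromℤ-+ (+ m) (+ n))

fromℕ-* : ∀ m n → fromℕ (m ℕ.* n) ≡ fromℕ m * fromℕ n
fromℕ-* m n = trans (cong fromℤ (ℤₚ.pos-* m n)) (fromℤ-* (+ m) (+ n))

fromℕ-mono : ∀ {m n} → m ℕ.≤ n → fromℕ m ≤ fromℕ n
fromℕ-mono m≤n = fromℤ-mono (ℤ.+≤+ m≤n)

0≤fromℕ : ∀ n → 0ℚ ≤ fromℕ n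
0≤fromℕ n = fromℕ-mono {0} {n} ℕ.z≤n

-- Finite sums

∑-mono : ∀ {n} {f g : Fin n → ℚ} → (∀ i → f i ≤ g i) → ∑ f ≤ ∑ g
∑-mono {zero}  h = ℚₚ.≤-refl
∑-mono {suc n} h = ℚₚ.+-mono-≤ (h zero) (∑-mono (h ∘ suc))

∑-const : ∀ n c → ∑ {n} (λ _ → c) ≡ fromℕ n * c
∑-const zero    c = sym (ℚₚ.*-zeroˡ c)
∑-const (suc n) c = begin
  c + ∑ {n} (λ _ → c)        ≡⟨ cong (λ z → c + z) (∑-const n c) ⟩
  c + fromℕ n * c            ≡⟨ alg c (fromℕ n) ⟩
  (1ℚ + fromℕ n) * c         ≡⟨ cong (_* c) (fromℕ-+ 1 n) ⟨
  fromℕ (suc n) * c          ∎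
  where
  open ≡-Reasoning
  alg : ∀ c m → c + m * c ≡ (1ℚ + m) * c
  alg = solve-∀ ringℚ

𝟙 : Bool → ℚ
𝟙 b = if b then 1ℚ else 0ℚ

δ : ∀ {n} → Fin n → Fin n → ℚ
δ i j = 𝟙 (does (i ≟ᶠ j))

δ-refl : ∀ {n} (i : Fin n) → δ i i ≡ 1ℚ
δ-refl i = cong 𝟙 (dec-true (i ≟ᶠ i) refl)

δ-sym : ∀ {n} (i j : Fin n) → δ i j ≡ δ j i
δ-sym i j with i ≟ᶠ j | j ≟ᶠ i
... | yes _   | yes _   = refl
... | no  _   | no  _   = refl
... | yes i≡j | no  j≢i = contradiction (sym i≡j) j≢i
... | no  i≢j | yes j≡i = contradiction (sym j≡i) i≢j

0≤𝟙 : ∀ b → 0ℚ ≤ 𝟙 b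
0≤𝟙 true  = 0≤1
0≤𝟙 false = ℚₚ.≤-refl

𝟙≤1 : ∀ b → 𝟙 b ≤ 1ℚ
𝟙≤1 true  = ℚₚ.≤-refl
𝟙≤1 false = 0≤1

0≤δ : ∀ {n} (i j : Fin n) → 0ℚ ≤ δ i j
0≤δ i j = 0≤𝟙 (does (i ≟ᶠ j))

δ≤1 : ∀ {n} (i j : Fin n) → δ i j ≤ 1ℚ
δ≤1 i j = 𝟙≤1 (does (i ≟ᶠ j))

-- Both terms are 1 only if `m` equals `i` and `j`. The correction `δ i j` replaces an assumption
-- `i ≢ j`, so that double sums may run over all pairs, the diagonal included.
δ-overlap : ∀ {n} (m i j : Fin n) → δ m i + δ m j ≤ 1ℚ + δ i j
δ-overlap m i j with m ≟ᶠ i | m ≟ᶠ j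
... | yes refl | yes refl = ℚₚ.≤-reflexive (cong (λ z → 1ℚ + z) (sym (δ-refl m)))
... | yes _    | no  _    = ℚₚ.+-monoʳ-≤ 1ℚ (0≤δ i j)
... | no  _    | yes _    = ℚₚ.≤-trans (ℚₚ.≤-reflexive (ℚₚ.+-comm 0ℚ 1ℚ)) (ℚₚ.+-monoʳ-≤ 1ℚ (0≤δ i j))
... | no  _    | no  _    = 0≤+ 0≤1 (0≤δ i j)

∑-δ : ∀ {n} (i : Fin n) (f : Fin n → ℚ) → ∑ (λ j → δ i j * f j) ≡ f i
∑-δ {suc n} zero f = begin
  1ℚ * f zero + ∑ (λ j → 0ℚ * f (suc j))  ≡⟨ cong₂ _+_ (ℚₚ.*-identityˡ (f zero)) (sym (*-distribˡ-sum 0ℚ (f ∘ suc))) ⟩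
  f zero + 0ℚ * ∑ (f ∘ suc)               ≡⟨ cong (λ z → f zero + z) (ℚₚ.*-zeroˡ (∑ (f ∘ suc))) ⟩
  f zero + 0ℚ                             ≡⟨ ℚₚ.+-identityʳ (f zero) ⟩
  f zero                                  ∎
  where open ≡-Reasoning
∑-δ {suc n} (suc i) f = begin
  0ℚ * f zero + ∑ (λ j → δ i j * f (suc j))  ≡⟨ cong₂ _+_ (ℚₚ.*-zeroˡ (f zero)) (∑-δ i (f ∘ suc)) ⟩
  0ℚ + f (suc i)                             ≡⟨ ℚₚ.+-identityˡ (f (suc i)) ⟩
  f (suc i)                                  ∎
  where open ≡-Reasoning

∑-δ1 : ∀ {n} (i : Fin n) → ∑ (δ i) ≡ 1ℚ
∑-δ1 i = trans (sum-cong-≗ (λ j → sym (ℚₚ.*-identityʳ (δ i j)))) (∑-δ i (λ _ → 1ℚ))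

δ-≢ : ∀ {n} {i j : Fin n} → i ≢ j → δ i j ≡ 0ℚ
δ-≢ {i = i} {j} i≢j = cong 𝟙 (dec-false (i ≟ᶠ j) i≢j)

∑-1 : ∀ n → ∑ {n} (λ _ → 1ℚ) ≡ fromℕ n
∑-1 n = trans (∑-const n 1ℚ) (ℚₚ.*-identityʳ (fromℕ n))

∑-nonneg : ∀ {n} {f : Fin n → ℚ} → (∀ i → 0ℚ ≤ f i) → 0ℚ ≤ ∑ f
∑-nonneg {n} {f} h = subst (_≤ ∑ f) (trans (∑-const n 0ℚ) (ℚₚ.*-zeroʳ (fromℕ n))) (∑-mono h)

∑∑-* : ∀ {m n} (f : Fin m → ℚ) (g : Fin n → ℚ) → ∑ (λ i → ∑ λ j → f i * g j) ≡ ∑ f * ∑ g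
∑∑-* f g = trans (sum-cong-≗ (λ i → sym (*-distribˡ-sum (f i) g))) (sym (*-distribʳ-sum (∑ g) f))

∑∑-+ : ∀ {m n} (f g : Fin m → Fin n → ℚ) →
       ∑ (λ i → ∑ λ j → f i j + g i j) ≡ ∑ (λ i → ∑ (f i)) + ∑ (λ i → ∑ (g i))
∑∑-+ f g = trans (sum-cong-≗ (λ i → ∑-distrib-+ (f i) (g i))) (∑-distrib-+ (λ i → ∑ (f i)) (λ i → ∑ (g i)))

∑-term : ∀ {n} {f : Fin n → ℚ} → (∀ i → 0ℚ ≤ f i) → ∀ i → f i ≤ ∑ f
∑-term {f = f} 0≤f i = subst (_≤ ∑ f) (∑-δ i f) (∑-mono pointwise)
  where
  pointwise : ∀ j → δ i j * f j ≤ f j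
  pointwise j with does (i ≟ᶠ j)
  ... | true  = ℚₚ.≤-reflexive (ℚₚ.*-identityˡ (f j))
  ... | false = ℚₚ.≤-trans (ℚₚ.≤-reflexive (ℚₚ.*-zeroˡ (f j))) (0≤f j)

-- A line of the grid is a row or a column; x j is the index of the part containing its j-th cell.

count : ∀ {k} → (Fin k → Fin k) → Fin k → ℚ
count x ℓ = ∑ λ j → δ (x j) ℓ

module _ {k : ℕ} (x : Fin k → Fin k) where

  private K = fromℕ k

  count-total : ∑ (count x) ≡ K
  count-total = begin
    ∑ (λ ℓ → ∑ λ j → δ (x j) ℓ)  ≡⟨ ∑-comm (λ ℓ j → δ (x j) ℓ) ⟩
    ∑ (λ j → ∑ λ ℓ → δ (x j) ℓ)  ≡⟨ sum-cong-≗ (λ j → ∑-δ1 (x j)) ⟩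
    ∑ {k} (λ _ → 1ℚ)             ≡⟨ ∑-1 k ⟩
    K                            ∎
    where open ≡-Reasoning

  count≤ : ∀ ℓ → count x ℓ ≤ K
  count≤ ℓ = ℚₚ.≤-trans (∑-mono (λ j → δ≤1 (x j) ℓ)) (ℚₚ.≤-reflexive (∑-1 k))

  count-disjoint : ∀ {ℓ m} → ℓ ≢ m → count x ℓ + count x m ≤ K
  count-disjoint {ℓ} {m} ℓ≢m = subst₂ _≤_ (∑-distrib-+ (λ j → δ (x j) ℓ) (λ j → δ (x j) m)) (∑-1 k)
    (∑-mono λ j → subst (λ z → δ (x j) ℓ + δ (x j) m ≤ 1ℚ + z) (δ-≢ ℓ≢m) (δ-overlap (x j) ℓ m))

  1≤count : ∀ j → 1ℚ ≤ count x (x j)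
  1≤count j = subst (_≤ count x (x j)) (∑-δ1 j) (∑-mono pointwise)
    where
    pointwise : ∀ m → δ j m ≤ δ (x m) (x j)
    pointwise m with j ≟ᶠ m
    ... | yes refl = ℚₚ.≤-reflexive (sym (δ-refl (x m)))
    ... | no  _    = 0≤δ (x m) (x j)

-- Lower bound for the cost of a single line

tent : ℚ → ℚ → ℚ
tent E t = t ⊓ (E - t)

tent-glb : ∀ E t {b} → b ≤ t → b ≤ E - t → b ≤ tent E t
tent-glb E t {b} = ℚₚ.⊓-glb {b} {t} {E - t}

-- The contribution of part `ℓ` to the cost of line `i`. The terminal of the line lies in part `i`,
-- so that part alone is charged through its complement.
lineTerm : ∀ {k} → ℚ → (Fin k → Fin k) → Fin k → Fin k → ℚ
lineTerm {k} E x i ℓ = if does (i ≟ᶠ ℓ) then tent E (fromℕ k - count x ℓ) else tent E (count x ℓ)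

lineCost : ∀ {k} → ℚ → (Fin k → Fin k) → Fin k → ℚ
lineCost E x i = ∑ (lineTerm E x i)

module _ {k : ℕ} (H : ℚ) (2H≤K : H + H ≤ fromℕ k) (x : Fin k → Fin k) (i : Fin k) where

  private
    K = fromℕ k
    E = (K - H) + (K - H)
    a = count x
    τ = tent E (K - a i)

  -- Measured against the generic cost `E`, the first alternative is a saving of 2(a i - H) through
  -- the own part, and the last a saving of 2(a ℓ - (K - H)) through another part.
  LineBound : ℚ → Set
  LineBound c = (K - a i) + (K - a i) ≤ c
              ⊎ E ≤ c
              ⊎ ∃[ ℓ ] (ℓ ≢ i × (E - a ℓ) + (E - a ℓ) ≤ c)

  -- A part `ℓ ≢ i` with at most K - H cells is on the rising branch and is charged at least `a ℓ`.
  -- As the counts sum to `K`, the cost is at least K - a i + τ if all other parts are like that. A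
  -- part `m` beyond K - H is charged E - a m instead, and there is at most one such part because it
  -- leaves no more than H ≤ K - H cells.
  lineCost-bound : LineBound (lineCost E x i)
  lineCost-bound = cases (anyᶠ? (λ ℓ → ¬? (ℓ ≟ᶠ i) ×-dec (K - H ℚₚ.<? a ℓ)))
   where
   cases : Dec (∃[ ℓ ] (ℓ ≢ i × K - H < a ℓ)) → LineBound (lineCost E x i)
   cases (no none) = bound (ℚₚ.⊓-sel (K - a i) (E - (K - a i)))
     where
     -- The decision is an argument so that matching on it reduces the indicator and the conditional
     -- together.
     term : ∀ ℓ (d : Dec (i ≡ ℓ)) →
            a ℓ + 𝟙 (does d) * (τ - a i) ≤ (if does d then tent E (K - a ℓ) else tent E (a ℓ))
     term ℓ (yes refl) = ℚₚ.≤-reflexive (alg (a ℓ) τ)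
       where
       alg : ∀ b t → b + 1ℚ * (t - b) ≡ t
       alg = solve-∀ ringℚ
     term ℓ (no i≢ℓ)   = subst (_≤ tent E (a ℓ)) (alg (a ℓ) (τ - a i))
                           (tent-glb E (a ℓ) ℚₚ.≤-refl (≤-by (0≤+ p p) (alg′ K H (a ℓ))))
       where
       alg : ∀ b t → b ≡ b + 0ℚ * t
       alg = solve-∀ ringℚ
       alg′ : ∀ K H b → (K - H - b) + (K - H - b) ≡ (K - H) + (K - H) - b - b
       alg′ = solve-∀ ringℚ
       p : 0ℚ ≤ K - H - a ℓ
       p = ≤⇒0≤- (ℚₚ.≮⇒≥ (λ lt → none (ℓ , (λ eq → i≢ℓ (sym eq)) , lt)))
     pointwise : ∀ ℓ → a ℓ + δ i ℓ * (τ - a i) ≤ lineTerm E x i ℓ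
     pointwise ℓ = term ℓ (i ≟ᶠ ℓ)
     total : K + (τ - a i) ≤ lineCost E x i
     total = subst (_≤ lineCost E x i)
       (trans (∑-distrib-+ a (λ ℓ → δ i ℓ * (τ - a i)))
              (cong₂ _+_ (count-total x) (∑-δ i (λ _ → τ - a i))))
       (∑-mono pointwise)
     -- The rising branch of τ turns the total into 2(K - a i), the falling branch into `E`.
     bound : τ ≡ K - a i ⊎ τ ≡ E - (K - a i) → LineBound (lineCost E x i)
     bound (inj₁ eq) = inj₁ (subst (_≤ lineCost E x i) (trans (cong (λ z → K + (z - a i)) eq) (alg K (a i))) total)
       where
       alg : ∀ K b → K + (K - b - b) ≡ (K - b) + (K - b)
       alg = solve-∀ ringℚ
     bound (inj₂ eq) = inj₂ (inj₁ (subst (_≤ lineCost E x i) (trans (cong (λ z → K + (z - a i)) eq) (alg K E (a i))) total))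
       where
       alg : ∀ K E b → K + (E - (K - b) - b) ≡ E
       alg = solve-∀ ringℚ
   cases (yes (m , m≢i , lt)) = inj₂ (inj₂ (m , m≢i , ℚₚ.≤-trans final total))
     where
     K-H≤am : 0ℚ ≤ a m - (K - H)
     K-H≤am = ≤⇒0≤- (ℚₚ.<⇒≤ lt)
     -- This includes `ℓ = i`, which `lowT` relies on.
     small : ∀ {ℓ} → ℓ ≢ m → a ℓ ≤ H
     small ℓ≢m = ≤-by (0≤+ K-H≤am (≤⇒0≤- (count-disjoint x ℓ≢m))) (alg K H (a m) (a _))
       where
       alg : ∀ K H b c → (b - (K - H)) + (K - (c + b)) ≡ H - c
       alg = solve-∀ ringℚ
     term : ∀ ℓ (d : Dec (i ≡ ℓ)) (d′ : Dec (m ≡ ℓ)) →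
            a ℓ + 𝟙 (does d) * (τ - a i) + 𝟙 (does d′) * (E - a m - a m)
              ≤ (if does d then tent E (K - a ℓ) else tent E (a ℓ))
     term ℓ (yes refl) (yes m≡i)  = contradiction m≡i m≢i
     term ℓ (yes refl) (no _)     = ℚₚ.≤-reflexive (alg (a ℓ) τ (E - a m - a m))
       where
       alg : ∀ b t z → b + 1ℚ * (t - b) + 0ℚ * z ≡ t
       alg = solve-∀ ringℚ
     term ℓ (no _)     (yes refl) = subst (_≤ tent E (a ℓ)) (alg (a ℓ) (τ - a i) E)
                                   (tent-glb E (a ℓ) (≤-by (0≤+ K-H≤am K-H≤am) (alg′ K H (a ℓ))) ℚₚ.≤-refl)
       where
       alg : ∀ b z E → E - b ≡ b + 0ℚ * z + 1ℚ * (E - b - b)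
       alg = solve-∀ ringℚ
       alg′ : ∀ K H b → (b - (K - H)) + (b - (K - H)) ≡ b - ((K - H) + (K - H) - b)
       alg′ = solve-∀ ringℚ
     term ℓ (no _)     (no m≢ℓ)   = subst (_≤ tent E (a ℓ)) (alg (a ℓ) (τ - a i) (E - a m - a m))
                                   (tent-glb E (a ℓ) ℚₚ.≤-refl (≤-by (0≤+ (0≤+ p p) (0≤+ q q)) (alg′ K H (a ℓ))))
       where
       alg : ∀ b t z → b ≡ b + 0ℚ * t + 0ℚ * z
       alg = solve-∀ ringℚ
       alg′ : ∀ K H b → ((H - b) + (H - b)) + ((K - (H + H)) + (K - (H + H))) ≡ (K - H) + (K - H) - b - b
       alg′ = solve-∀ ringℚ
       p = ≤⇒0≤- (small (λ eq → m≢ℓ (sym eq)))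
       q = ≤⇒0≤- 2H≤K
     pointwise : ∀ ℓ → a ℓ + δ i ℓ * (τ - a i) + δ m ℓ * (E - a m - a m) ≤ lineTerm E x i ℓ
     pointwise ℓ = term ℓ (i ≟ᶠ ℓ) (m ≟ᶠ ℓ)
     total : K + (τ - a i) + (E - a m - a m) ≤ lineCost E x i
     total = subst (_≤ lineCost E x i)
       (trans (∑-distrib-+ (λ ℓ → a ℓ + δ i ℓ * (τ - a i)) (λ ℓ → δ m ℓ * (E - a m - a m)))
         (cong₂ _+_
           (trans (∑-distrib-+ a (λ ℓ → δ i ℓ * (τ - a i)))
                  (cong₂ _+_ (count-total x) (∑-δ i (λ _ → τ - a i))))
           (∑-δ m (λ _ → E - a m - a m))))
       (∑-mono pointwise)
     -- Since a i ≤ H, the complement of the own part has at least K - H cells and lies on the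
     -- falling branch.
     lowT : E - (K - a i) ≤ τ
     lowT = tent-glb E (K - a i) (≤-by (0≤+ p p) (alg K H (a i))) ℚₚ.≤-refl
       where
       p = ≤⇒0≤- (small {i} (λ eq → m≢i (sym eq)))
       alg : ∀ K H b → (H - b) + (H - b) ≡ (K - b) - ((K - H) + (K - H) - (K - b))
       alg = solve-∀ ringℚ
     final : (E - a m) + (E - a m) ≤ K + (τ - a i) + (E - a m - a m)
     final = ≤-by (≤⇒0≤- lowT) (alg K E (a i) (a m) τ)
       where
       alg : ∀ K E b c t → t - (E - (K - b)) ≡ (K + (t - b) + (E - c - c)) - ((E - c) + (E - c))
       alg = solve-∀ ringℚ

-- Double counting of the savings

-- The kind of a line i records which term dominates its saving over the generic cost 2(k − h):
-- its own part i, another part ℓ, or none.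
data Kind (n : ℕ) : Set where
  own plain : Kind n
  other     : Fin n → Kind n

module _ {n : ℕ} where

  isOwn isOther notOther : Kind n → ℚ
  isOwn own       = 1ℚ
  isOwn plain     = 0ℚ
  isOwn (other _) = 0ℚ
  isOther own       = 0ℚ
  isOther plain     = 0ℚ
  isOther (other _) = 1ℚ
  notOther own       = 1ℚ
  notOther plain     = 1ℚ
  notOther (other _) = 0ℚ

  -- The exceptional crossing of a line of kind `other ℓ`: only with line `ℓ` itself can it share
  -- the part `ℓ` profitably. There is one such crossing per line, so these terms add up to O(k).
  points : Kind n → Fin n → ℚ
  points own       _ = 0ℚ
  points plain     _ = 0ℚ
  points (other ℓ) j = δ ℓ j

  -- Half the saving of line i is the sum of these weights over its cells, m being the part of the cell,
  -- plus h (isOther κ − isOwn κ).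
  weight : Kind n → Fin n → Fin n → ℚ
  weight own       i m = δ m i
  weight plain     i m = 0ℚ
  weight (other ℓ) i m = δ m ℓ - 1ℚ

  -- The cells (i, j) and (j, i) lie in the same part `m`. Two lines of kind `own` gain at most 1
  -- together, as `m` cannot be both `i` and `j`; this is the 1 + 1 - 1 left after moving the
  -- product to the right. Next to a line of kind `other ℓ`, a line of kind `own` gains nothing in
  -- total: either `m` is not its index or the weight -1 of the other line cancels the gain. The
  -- exceptions `i = j`, `ℓ = i` and `ℓ = j` are paid for by the last three terms.
  weight-pair : ∀ κ κ′ i j m →
    weight κ i m + weight κ′ j m + isOwn κ * isOwn κ′
      ≤ isOwn κ * notOther κ′ + notOther κ * isOwn κ′ + points κ j + points κ′ i + δ i j * isOwn κ
  weight-pair own own i j m = ≤-by (≤⇒0≤- (δ-overlap m i j)) (alg (δ m i) (δ m j) (δ i j))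
    where
    alg : ∀ a b c → (1ℚ + c) - (a + b) ≡ (1ℚ * 1ℚ + 1ℚ * 1ℚ + 0ℚ + 0ℚ + c * 1ℚ) - (a + b + 1ℚ * 1ℚ)
    alg = solve-∀ ringℚ
  weight-pair own plain i j m = ≤-by (0≤+ (≤⇒0≤- (δ≤1 m i)) (0≤δ i j)) (alg (δ m i) (δ i j))
    where
    alg : ∀ a c → (1ℚ - a) + c ≡ (1ℚ * 1ℚ + 1ℚ * 0ℚ + 0ℚ + 0ℚ + c * 1ℚ) - (a + 0ℚ + 1ℚ * 0ℚ)
    alg = solve-∀ ringℚ
  weight-pair own (other ℓ) i j m =
    ≤-by (0≤+ (≤⇒0≤- (δ-overlap m ℓ i)) (0≤δ i j)) (alg (δ m i) (δ m ℓ) (δ ℓ i) (δ i j))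
    where
    alg : ∀ a b d c → ((1ℚ + d) - (b + a)) + c
                      ≡ (1ℚ * 0ℚ + 1ℚ * 0ℚ + 0ℚ + d + c * 1ℚ) - (a + (b - 1ℚ) + 1ℚ * 0ℚ)
    alg = solve-∀ ringℚ
  weight-pair plain own i j m = ≤-by (≤⇒0≤- (δ≤1 m j)) (alg (δ m j) (δ i j))
    where
    alg : ∀ a c → 1ℚ - a ≡ (0ℚ * 1ℚ + 1ℚ * 1ℚ + 0ℚ + 0ℚ + c * 0ℚ) - (0ℚ + a + 0ℚ * 1ℚ)
    alg = solve-∀ ringℚ
  weight-pair plain plain i j m = ≤-by (ℚₚ.≤-refl {0ℚ}) (alg (δ i j))
    where
    alg : ∀ c → 0ℚ ≡ (0ℚ * 1ℚ + 1ℚ * 0ℚ + 0ℚ + 0ℚ + c * 0ℚ) - (0ℚ + 0ℚ + 0ℚ * 0ℚ)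
    alg = solve-∀ ringℚ
  weight-pair plain (other ℓ) i j m =
    ≤-by (0≤+ (≤⇒0≤- (δ≤1 m ℓ)) (0≤δ ℓ i)) (alg (δ m ℓ) (δ ℓ i) (δ i j))
    where
    alg : ∀ a d c → (1ℚ - a) + d ≡ (0ℚ * 0ℚ + 1ℚ * 0ℚ + 0ℚ + d + c * 0ℚ) - (0ℚ + (a - 1ℚ) + 0ℚ * 0ℚ)
    alg = solve-∀ ringℚ
  weight-pair (other ℓ) own i j m =
    ≤-by (≤⇒0≤- (δ-overlap m ℓ j)) (alg (δ m j) (δ m ℓ) (δ ℓ j) (δ i j))
    where
    alg : ∀ a b d c → (1ℚ + d) - (b + a)
                      ≡ (0ℚ * 1ℚ + 0ℚ * 1ℚ + d + 0ℚ + c * 0ℚ) - ((b - 1ℚ) + a + 0ℚ * 1ℚ)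
    alg = solve-∀ ringℚ
  weight-pair (other ℓ) plain i j m =
    ≤-by (0≤+ (≤⇒0≤- (δ≤1 m ℓ)) (0≤δ ℓ j)) (alg (δ m ℓ) (δ ℓ j) (δ i j))
    where
    alg : ∀ a d c → (1ℚ - a) + d ≡ (0ℚ * 1ℚ + 0ℚ * 0ℚ + d + 0ℚ + c * 0ℚ) - ((a - 1ℚ) + 0ℚ + 0ℚ * 0ℚ)
    alg = solve-∀ ringℚ
  weight-pair (other ℓ) (other ℓ′) i j m =
    ≤-by (0≤+ (0≤+ (≤⇒0≤- (δ≤1 m ℓ)) (≤⇒0≤- (δ≤1 m ℓ′))) (0≤+ (0≤δ ℓ j) (0≤δ ℓ′ i)))
         (alg (δ m ℓ) (δ m ℓ′) (δ ℓ j) (δ ℓ′ i) (δ i j))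
    where
    alg : ∀ a b d e c → ((1ℚ - a) + (1ℚ - b)) + (d + e)
                        ≡ (0ℚ * 0ℚ + 0ℚ * 0ℚ + d + e + c * 0ℚ) - ((a - 1ℚ) + (b - 1ℚ) + 0ℚ * 0ℚ)
    alg = solve-∀ ringℚ

  ∑-points : ∀ κ → ∑ (points κ) ≡ isOther κ
  ∑-points own       = trans (∑-const n 0ℚ) (ℚₚ.*-zeroʳ (fromℕ n))
  ∑-points plain     = trans (∑-const n 0ℚ) (ℚₚ.*-zeroʳ (fromℕ n))
  ∑-points (other ℓ) = ∑-δ1 ℓ

  0≤isOwn : ∀ κ → 0ℚ ≤ isOwn κ
  0≤isOwn own       = 0≤1
  0≤isOwn plain     = ℚₚ.≤-refl
  0≤isOwn (other _) = ℚₚ.≤-refl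

  0≤isOther : ∀ κ → 0ℚ ≤ isOther κ
  0≤isOther own       = ℚₚ.≤-refl
  0≤isOther plain     = ℚₚ.≤-refl
  0≤isOther (other _) = 0≤1

  notOther+isOther : ∀ κ → notOther κ + isOther κ ≡ 1ℚ
  notOther+isOther own       = refl
  notOther+isOther plain     = refl
  notOther+isOther (other _) = refl

  isOwn≤notOther : ∀ κ → isOwn κ ≤ notOther κ
  isOwn≤notOther own       = ℚₚ.≤-refl
  isOwn≤notOther plain     = 0≤1
  isOwn≤notOther (other _) = ℚₚ.≤-refl

module _ {k : ℕ} (L : Fin k → Fin k → Fin k) (L-sym : ∀ i j → L i j ≡ L j i) (κ : Fin k → Kind k) where

  private
    K = fromℕ k
    p q r : Fin k → ℚ
    p = isOwn ∘ κ
    q = isOther ∘ κ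
    r = notOther ∘ κ
    P = ∑ p
    Q = ∑ q
    R = ∑ r
    w : Fin k → Fin k → ℚ
    w i j = weight (κ i) i (L i j)
    e e′ d : Fin k → Fin k → ℚ
    e i j = points (κ i) j
    e′ i j = points (κ j) i
    d i j = δ i j * p i

  -- `weight-pair` summed over all ordered pairs, where by symmetry of `L` every weight occurs
  -- twice.
  ∑-weight-bound : let W = ∑ λ i → ∑ λ j → weight (κ i) i (L i j) in
                   W + W + P * P ≤ P * R + R * P + Q + Q + P
  ∑-weight-bound = subst₂ _≤_ lhs rhs (∑-mono λ i → ∑-mono λ j → cell i j)
    where
    cell : ∀ i j → w i j + w j i + p i * p j ≤ p i * r j + r i * p j + e i j + e′ i j + d i j
    cell i j = subst (λ m → w i j + weight (κ j) j m + p i * p j ≤ p i * r j + r i * p j + e i j + e′ i j + d i j)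
      (L-sym i j) (weight-pair (κ i) (κ j) i j (L i j))
    lhs : ∑ (λ i → ∑ λ j → w i j + w j i + p i * p j) ≡ ∑ (λ i → ∑ (w i)) + ∑ (λ i → ∑ (w i)) + P * P
    lhs = trans (∑∑-+ (λ i j → w i j + w j i) (λ i j → p i * p j))
      (cong₂ _+_ (trans (∑∑-+ w (λ i j → w j i)) (cong (λ z → ∑ (λ i → ∑ (w i)) + z) (∑-comm (λ i j → w j i))))
                 (∑∑-* p p))
    eQ : ∑ (λ i → ∑ (e i)) ≡ Q
    eQ = sum-cong-≗ (λ i → ∑-points (κ i))
    rhs : ∑ (λ i → ∑ λ j → p i * r j + r i * p j + e i j + e′ i j + d i j) ≡ P * R + R * P + Q + Q + P
    rhs = trans (∑∑-+ (λ i j → p i * r j + r i * p j + e i j + e′ i j) d) (cong₂ _+_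
      (trans (∑∑-+ (λ i j → p i * r j + r i * p j + e i j) e′) (cong₂ _+_
        (trans (∑∑-+ (λ i j → p i * r j + r i * p j) e) (cong₂ _+_
          (trans (∑∑-+ (λ i j → p i * r j) (λ i j → r i * p j)) (cong₂ _+_ (∑∑-* p r) (∑∑-* r p)))
          eQ))
        (trans (∑-comm e′) eQ)))
      (sum-cong-≗ (λ i → ∑-δ i (λ _ → p i))))

  private
    0≤P = ∑-nonneg (λ i → 0≤isOwn (κ i))
    0≤Q = ∑-nonneg (λ i → 0≤isOther (κ i))
    P≤R = ∑-mono (λ i → isOwn≤notOther (κ i))
    0≤R-P = ≤⇒0≤- P≤R
    0≤R = ℚₚ.≤-trans 0≤P P≤R
    slack = ≤⇒0≤- ∑-weight-bound
    -- This is the slack in Q + Q + P ≤ 3(R + Q), which disposes of the linear terms.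
    0≤free : 0ℚ ≤ (R - P) + (R + R + Q)
    0≤free = 0≤+ 0≤R-P (0≤+ (0≤+ 0≤R 0≤R) 0≤Q)

  R+Q≡K : R + Q ≡ K
  R+Q≡K = trans (sym (∑-distrib-+ r q)) (trans (sum-cong-≗ (λ i → notOther+isOther (κ i))) (∑-1 k))

  -- Up to linear terms the doubled saving is at most 2P(K - Q) - P² + 2H(Q - P), which is linear in
  -- `Q` with slope 2(H - P); hence the comparison of `P` with `H`. For P ≤ H it falls short of 2KH
  -- by 2R(H - P) + P² + 2HP. For P ≥ H it is largest at Q = 0, where it equals (K - H)² - (K - H -
  -- P)².
  ∑-weight-cases : ∀ {H} → 0ℚ ≤ H → let W = ∑ λ i → ∑ λ j → weight (κ i) i (L i j) in
    (W + H * (Q - P)) + (W + H * (Q - P)) ≤ fromℕ 2 * K * H + fromℕ 3 * K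
    ⊎ (W + H * (Q - P)) + (W + H * (Q - P)) ≤ (K - H) * (K - H) + fromℕ 3 * K
  ∑-weight-cases {H} 0≤H rewrite sym R+Q≡K with ℚₚ.≤-total P H
  ... | inj₁ P≤H = inj₁ (≤-by
          (0≤+ (0≤+ (0≤+ (0≤+ 0≤free (0≤+ (0≤* 0≤R-P 0≤H-P) (0≤* 0≤R-P 0≤H-P)))
            (0≤+ (0≤* 0≤H 0≤P) (0≤+ (0≤* 0≤H 0≤P) (0≤* 0≤H 0≤P)))) (0≤* 0≤P 0≤H-P)) slack)
          (alg H P Q R (∑ λ i → ∑ λ j → w i j)))
    where
    0≤H-P = ≤⇒0≤- P≤H
    alg : ∀ H P Q R W →
      (R - P) + (R + R + Q) + ((R - P) * (H - P) + (R - P) * (H - P))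
        + (H * P + (H * P + H * P)) + P * (H - P)
        + ((P * R + R * P + Q + Q + P) - (W + W + P * P))
      ≡ (fromℕ 2 * (R + Q) * H + fromℕ 3 * (R + Q)) - ((W + H * (Q - P)) + (W + H * (Q - P)))
    alg = solve-∀ ringℚ
  ... | inj₂ H≤P = inj₂ (≤-by
          (0≤+ (0≤+ (0≤+ 0≤free (0≤square (R + Q - H - P)))
            (0≤+ (0≤* 0≤Q 0≤P-H) (0≤* 0≤Q 0≤P-H))) slack)
          (alg H P Q R (∑ λ i → ∑ λ j → w i j)))
    where
    0≤P-H = ≤⇒0≤- H≤P
    alg : ∀ H P Q R W →
      (R - P) + (R + R + Q) + (R + Q - H - P) * (R + Q - H - P)
        + (Q * (P - H) + Q * (P - H))
        + ((P * R + R * P + Q + Q + P) - (W + W + P * P))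
      ≡ ((R + Q - H) * (R + Q - H) + fromℕ 3 * (R + Q)) - ((W + H * (Q - P)) + (W + H * (Q - P)))
    alg = solve-∀ ringℚ

-- Costs of assignments

fromℕ-∑ : ∀ {n} (f : Fin n → ℕ) → fromℕ (∑ℕ f) ≡ ∑ (fromℕ ∘ f)
fromℕ-∑ {zero}  f = refl
fromℕ-∑ {suc n} f = trans (fromℕ-+ (f zero) (∑ℕ (f ∘ suc))) (cong (λ z → fromℕ (f zero) + z) (fromℕ-∑ (f ∘ suc)))

fromℕ-𝟙 : ∀ b → fromℕ (if b then 1 else 0) ≡ 𝟙 b
fromℕ-𝟙 true  = refl
fromℕ-𝟙 false = refl

𝟙-∧ : ∀ a b → 𝟙 (a ∧ b) ≡ 𝟙 b * 𝟙 a
𝟙-∧ true  b = sym (ℚₚ.*-identityʳ (𝟙 b))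
𝟙-∧ false b = sym (ℚₚ.*-zeroʳ (𝟙 b))

module _ {k : ℕ} where

  fromℕ-card : (S : Subset k) → fromℕ (card S) ≡ ∑ λ i → ∑ λ j → 𝟙 (S (i , j))
  fromℕ-card S = trans (fromℕ-∑ (λ i → ∑ℕ λ j → if S (i , j) then 1 else 0))
    (sum-cong-≗ λ i → trans (fromℕ-∑ (λ j → if S (i , j) then 1 else 0)) (sum-cong-≗ λ j → fromℕ-𝟙 (S (i , j))))

  card-∩-row : ∀ (S : Subset k) i → fromℕ (card (S ∩ row i)) ≡ ∑ λ j → 𝟙 (S (i , j))
  card-∩-row S i = begin
    fromℕ (card (S ∩ row i))
      ≡⟨ fromℕ-card (S ∩ row i) ⟩
    ∑ (λ a → ∑ λ b → 𝟙 (S (a , b) ∧ does (a ≟ᶠ i)))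
      ≡⟨ sum-cong-≗ (λ a → trans (sum-cong-≗ λ b → trans (𝟙-∧ (S (a , b)) _) (cong (_* 𝟙 (S (a , b))) (δ-sym a i)))
                                 (sym (*-distribˡ-sum (δ i a) (λ b → 𝟙 (S (a , b)))))) ⟩
    ∑ (λ a → δ i a * ∑ λ b → 𝟙 (S (a , b)))
      ≡⟨ ∑-δ i (λ a → ∑ λ b → 𝟙 (S (a , b))) ⟩
    ∑ (λ j → 𝟙 (S (i , j))) ∎
    where open ≡-Reasoning

  card-∩-column : ∀ (S : Subset k) i → fromℕ (card (S ∩ column i)) ≡ ∑ λ j → 𝟙 (S (j , i))
  card-∩-column S i = begin
    fromℕ (card (S ∩ column i))
      ≡⟨ fromℕ-card (S ∩ column i) ⟩
    ∑ (λ a → ∑ λ b → 𝟙 (S (a , b) ∧ does (b ≟ᶠ i)))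
      ≡⟨ sum-cong-≗ (λ a → trans (sum-cong-≗ λ b → trans (𝟙-∧ (S (a , b)) _) (cong (_* 𝟙 (S (a , b))) (δ-sym b i)))
                                 (∑-δ i (λ b → 𝟙 (S (a , b))))) ⟩
    ∑ (λ j → 𝟙 (S (j , i))) ∎
    where open ≡-Reasoning

-- The threshold k - γ/2 is half of `E`, the point where `t` and `E − t` cross, so the case
-- distinction always selects the smaller of the two.
φ-tent : ∀ k {γ H} → γ ≡ fromℕ 2 * H → ∀ t → φ k γ t ≡ tent ((fromℕ k - H) + (fromℕ k - H)) t
φ-tent k {H = H} refl t with t ℚ.≤ᵇ (fromℕ k - fromℕ 2 * H * ½) in eq
... | true  = sym (ℚₚ.p≤q⇒p⊓q≡p {t} (≤-by (0≤+ p p) (alg (fromℕ k) H t)))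
  where
  p = ≤⇒0≤- (ℚₚ.≤ᵇ⇒≤ {t} {fromℕ k - fromℕ 2 * H * ½} (subst T (sym eq) tt))
  alg : ∀ K H t → (K - fromℕ 2 * H * ½ - t) + (K - fromℕ 2 * H * ½ - t) ≡ (K - H) + (K - H) - t - t
  alg = solve-∀ ringℚ
... | false = trans (alg′ (fromℕ k) H t) (sym (ℚₚ.p≥q⇒p⊓q≡q {t} (≤-by (0≤+ p p) (alg (fromℕ k) H t))))
  where
  p = ≤⇒0≤- (ℚₚ.<⇒≤ (ℚₚ.≰⇒> {t} {fromℕ k - fromℕ 2 * H * ½} (λ le → subst T eq (ℚₚ.≤⇒≤ᵇ le))))
  alg : ∀ K H t → (t - (K - fromℕ 2 * H * ½)) + (t - (K - fromℕ 2 * H * ½)) ≡ t - ((K - H) + (K - H) - t)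
  alg = solve-∀ ringℚ
  alg′ : ∀ K H t → fromℕ 2 * K - t - fromℕ 2 * H ≡ (K - H) + (K - H) - t
  alg′ = solve-∀ ringℚ

module _ {k : ℕ} (A : Assignment k) where

  label : Fin k → Fin k → Fin k
  label i j = proj₁ (partition A (i , j))

  label-unique : ∀ {i j ℓ} → (i , j) ∈ part A ℓ → label i j ≡ ℓ
  label-unique {i} {j} = proj₂ (proj₂ (partition A (i , j)))

  label-terminal : ∀ i → label i i ≡ i
  label-terminal i = label-unique (terminals A i)

  part-label : ∀ ℓ i j → part A ℓ (i , j) ≡ does (label i j ≟ᶠ ℓ)
  part-label ℓ i j with label i j ≟ᶠ ℓ
  ... | yes refl = proj₁ (proj₂ (partition A (i , j)))
  ... | no  ≢ℓ with part A ℓ (i , j) in eq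
  ...   | true  = contradiction (label-unique eq) ≢ℓ
  ...   | false = refl

  label-sym : Symmetric A → ∀ i j → label i j ≡ label j i
  label-sym sy i j with sy i j
  ... | ℓ , p , q = trans (label-unique p) (sym (label-unique q))

  part-terminal : ∀ ℓ i b → b ≡ true → (part A ℓ (terminal i) ∧ b) ≡ does (i ≟ᶠ ℓ)
  part-terminal ℓ i .true refl = trans (∧-identityʳ (part A ℓ (terminal i)))
    (trans (part-label ℓ i i) (cong (λ m → does (m ≟ᶠ ℓ)) (label-terminal i)))

  module _ {γ H : ℚ} (γ≡ : γ ≡ fromℕ 2 * H) where

    private
      K = fromℕ k
      E = (K - H) + (K - H)

    g-lineTerm : ∀ i ℓ (S : Subset k) (x : Fin k → Fin k) → S (terminal i) ≡ does (i ≟ᶠ ℓ) →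
                 fromℕ (card S) ≡ count x ℓ → g γ i S ≡ lineTerm E x i ℓ
    g-lineTerm i ℓ S x eqt eqc = trans
      (cong₂ (λ b a → if b then φ k γ (K - a) else φ k γ a) eqt eqc)
      (if-tent (does (i ≟ᶠ ℓ)) (count x ℓ))
      where
      if-tent : ∀ b a → (if b then φ k γ (K - a) else φ k γ a) ≡ (if b then tent E (K - a) else tent E a)
      if-tent true  a = φ-tent k γ≡ (K - a)
      if-tent false a = φ-tent k γ≡ a

    -- Exchanging the sums over parts and over lines lets each row and each column be estimated
    -- separately.
    cost-lines : cost γ A ≡ ∑ (λ i → lineCost E (label i) i) + ∑ (λ i → lineCost E (λ j → label j i) i)
    cost-lines = begin
      ∑ (λ ℓ → ∑ (λ i → g γ i (part A ℓ ∩ row i)) + ∑ (λ i → g γ i (part A ℓ ∩ column i)))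
        ≡⟨ sum-cong-≗ (λ ℓ → cong₂ _+_ (sum-cong-≗ (λ i → rowTerm ℓ i)) (sum-cong-≗ (λ i → columnTerm ℓ i))) ⟩
      ∑ (λ ℓ → ∑ (λ i → lineTerm E (label i) i ℓ) + ∑ (λ i → lineTerm E (λ j → label j i) i ℓ))
        ≡⟨ ∑-distrib-+ (λ ℓ → ∑ (λ i → lineTerm E (label i) i ℓ)) (λ ℓ → ∑ (λ i → lineTerm E (λ j → label j i) i ℓ)) ⟩
      ∑ (λ ℓ → ∑ (λ i → lineTerm E (label i) i ℓ)) + ∑ (λ ℓ → ∑ (λ i → lineTerm E (λ j → label j i) i ℓ))
        ≡⟨ cong₂ _+_ (∑-comm (λ ℓ i → lineTerm E (label i) i ℓ)) (∑-comm (λ ℓ i → lineTerm E (λ j → label j i) i ℓ)) ⟩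
      ∑ (λ i → lineCost E (label i) i) + ∑ (λ i → lineCost E (λ j → label j i) i) ∎
      where
      open ≡-Reasoning
      rowTerm : ∀ ℓ i → g γ i (part A ℓ ∩ row i) ≡ lineTerm E (label i) i ℓ
      rowTerm ℓ i = g-lineTerm i ℓ (part A ℓ ∩ row i) (label i)
        (part-terminal ℓ i _ (dec-true (i ≟ᶠ i) refl))
        (trans (card-∩-row (part A ℓ) i) (sum-cong-≗ λ j → cong 𝟙 (part-label ℓ i j)))
      columnTerm : ∀ ℓ i → g γ i (part A ℓ ∩ column i) ≡ lineTerm E (λ j → label j i) i ℓ
      columnTerm ℓ i = g-lineTerm i ℓ (part A ℓ ∩ column i) (λ j → label j i)
        (part-terminal ℓ i _ (dec-true (i ≟ᶠ i) refl))
        (trans (card-∩-column (part A ℓ) i) (sum-cong-≗ λ j → cong 𝟙 (part-label ℓ j i)))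

-- Positivity of the cost

module _ {k : ℕ} {H : ℚ} (2H≤K : H + H ≤ fromℕ k) (1≤K : 1ℚ ≤ fromℕ k)
         (x : Fin k → Fin k) (i : Fin k) (xi≡i : x i ≡ i) where

  private
    K = fromℕ k
    E = (K - H) + (K - H)
    c = lineCost E x i

    twice : ∀ t → 1ℚ ≤ t → t + t ≤ c → 1ℚ ≤ c
    twice t 1≤t h = ℚₚ.≤-trans 1≤t (ℚₚ.≤-trans (≤-by (ℚₚ.≤-trans 0≤1 1≤t) (alg t)) h)
      where
      alg : ∀ t → t ≡ t + t - t
      alg = solve-∀ ringℚ

    K≤E : 0ℚ ≤ E - K
    K≤E = subst (0ℚ ≤_) (alg K H) (≤⇒0≤- 2H≤K)
      where
      alg : ∀ K H → K - (H + H) ≡ (K - H) + (K - H) - K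
      alg = solve-∀ ringℚ

    -- Here E ≥ K ≥ 1, and E - a ℓ ≥ K - a ℓ ≥ a i ≥ 1 because the terminal lies in part `i`.
    othersBound : E ≤ c ⊎ ∃[ ℓ ] (ℓ ≢ i × (E - count x ℓ) + (E - count x ℓ) ≤ c) → 1ℚ ≤ c
    othersBound (inj₁ h) = ℚₚ.≤-trans 1≤K (ℚₚ.≤-trans (≤-by K≤E refl) h)
    othersBound (inj₂ (ℓ , ℓ≢i , h)) = twice (E - count x ℓ)
      (≤-by (0≤+ (0≤+ K≤E (≤⇒0≤- (count-disjoint x ℓ≢i))) (≤⇒0≤- 1≤i)) (alg K E (count x ℓ) (count x i))) h
      where
      1≤i : 1ℚ ≤ count x i
      1≤i = subst (λ z → 1ℚ ≤ count x z) xi≡i (1≤count x i)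
      alg : ∀ K E a b → (E - K) + (K - (a + b)) + (b - 1ℚ) ≡ (E - a) - 1ℚ
      alg = solve-∀ ringℚ

  0≤lineCost : 0ℚ ≤ lineCost E x i
  0≤lineCost = [ (λ h → ℚₚ.≤-trans (0≤+ (≤⇒0≤- (count≤ x i)) (≤⇒0≤- (count≤ x i))) h)
               , (λ h → ℚₚ.≤-trans 0≤1 (othersBound h)) ]′ (lineCost-bound H 2H≤K x i)

  -- Only the first alternative of `LineBound` allows a cost below 1, and a cell outside part `i`
  -- makes K - a i at least 1.
  1≤lineCost : ∀ j → x j ≢ i → 1ℚ ≤ lineCost E x i
  1≤lineCost j xj≢i = [ twice (K - count x i) K-aᵢ≥1 , othersBound ]′ (lineCost-bound H 2H≤K x i)
    where
    alg : ∀ K a b → (K - (a + b)) + (a - 1ℚ) ≡ (K - b) - 1ℚ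
    alg = solve-∀ ringℚ
    K-aᵢ≥1 : 1ℚ ≤ K - count x i
    K-aᵢ≥1 = ≤-by (0≤+ (≤⇒0≤- (count-disjoint x xj≢i)) (≤⇒0≤- (1≤count x j)))
                  (alg K (count x (x j)) (count x i))

-- Keeps the ratio away from the convention 1/0 = 0. The cell (0, 1) is not in both part 0 and part
-- 1, so row 0 or column 1 contains a cell outside its own part.
cost-positive : ∀ {k γ H} → 2 ℕ.≤ k → γ ≡ fromℕ 2 * H → H + H ≤ fromℕ k → (A : Assignment k) → 0ℚ < cost γ A
cost-positive {suc (suc k)} {γ} {H} (ℕ.s≤s (ℕ.s≤s _)) γ≡ 2H≤K A =
  ℚₚ.<-≤-trans (ℚₚ.positive⁻¹ 1ℚ) (subst (1ℚ ≤_) (sym (cost-lines A γ≡)) (cases (L 0F 1F ≟ᶠ 0F)))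
  where
  L = label A
  K = fromℕ (suc (suc k))
  E = (K - H) + (K - H)
  1≤K : 1ℚ ≤ K
  1≤K = fromℕ-mono {1} {suc (suc k)} (ℕ.s≤s ℕ.z≤n)
  rowCost columnCost : Fin (suc (suc k)) → ℚ
  rowCost i = lineCost E (L i) i
  columnCost i = lineCost E (λ j → L j i) i
  0≤rowCost : ∀ i → 0ℚ ≤ rowCost i
  0≤rowCost i = 0≤lineCost 2H≤K 1≤K (L i) i (label-terminal A i)
  0≤columnCost : ∀ i → 0ℚ ≤ columnCost i
  0≤columnCost i = 0≤lineCost 2H≤K 1≤K (λ j → L j i) i (label-terminal A i)
  cases : Dec (L 0F 1F ≡ 0F) → 1ℚ ≤ ∑ rowCost + ∑ columnCost
  cases (no L≢0) = ℚₚ.+-mono-≤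
    (ℚₚ.≤-trans (1≤lineCost 2H≤K 1≤K (L 0F) 0F (label-terminal A 0F) 1F L≢0) (∑-term 0≤rowCost 0F))
    (∑-nonneg 0≤columnCost)
  cases (yes L≡0) = ℚₚ.+-mono-≤
    (∑-nonneg 0≤rowCost)
    (ℚₚ.≤-trans (1≤lineCost 2H≤K 1≤K (λ j → L j 1F) 1F (label-terminal A 1F) 0F L≢1) (∑-term 0≤columnCost 1F))
    where
    L≢1 : L 0F 1F ≢ 1F
    L≢1 eq with trans (sym L≡0) eq
    ... | ()

-- Upper bound from the assignment into rows

rowAssignment : ∀ k → Assignment k
rowAssignment k .part ℓ (i , j) = does (i ≟ᶠ ℓ)
rowAssignment k .partition (i , j) = i , dec-true (i ≟ᶠ i) refl , unique
  where
  unique : ∀ {ℓ} → does (i ≟ᶠ ℓ) ≡ true → i ≡ ℓ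
  unique {ℓ} eq with i ≟ᶠ ℓ
  ... | yes i≡ℓ = i≡ℓ
  unique {ℓ} () | no _
rowAssignment k .terminals ℓ = dec-true (ℓ ≟ᶠ ℓ) refl

-- Rows are monochromatic and cost nothing. A column has one cell in each part: every foreign part
-- costs at most 1 and the own part at most E - (K - 1), together `E`.
rowAssignment-cost : ∀ {k γ H} → γ ≡ fromℕ 2 * H →
                     cost γ (rowAssignment k) ≤ fromℕ k * ((fromℕ k - H) + (fromℕ k - H))
rowAssignment-cost {k} {γ} {H} γ≡ = ℚₚ.≤-trans (ℚₚ.≤-reflexive (cost-lines (rowAssignment k) γ≡))
  (ℚₚ.≤-trans (ℚₚ.+-mono-≤ rows columns) (ℚₚ.≤-reflexive (ℚₚ.+-identityˡ (K * E))))
  where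
  K = fromℕ k
  E = (K - H) + (K - H)
  ∑0 : ∑ {k} (λ _ → 0ℚ) ≡ 0ℚ
  ∑0 = trans (∑-const k 0ℚ) (ℚₚ.*-zeroʳ K)
  tent≤ˡ : ∀ t → tent E t ≤ t
  tent≤ˡ t = ℚₚ.p⊓q≤p t (E - t)
  tent≤ʳ : ∀ t → tent E t ≤ E - t
  tent≤ʳ t = ℚₚ.p⊓q≤q t (E - t)
  rowBound : ∀ i → lineCost E (λ _ → i) i ≤ 0ℚ
  rowBound i = subst (lineCost E (λ _ → i) i ≤_) ∑0 (∑-mono pointwise)
    where
    term : ∀ b → let a = ∑ {k} (λ _ → 𝟙 b) in (if b then tent E (K - a) else tent E a) ≤ 0ℚ
    term true  = ℚₚ.≤-trans (tent≤ˡ (K - ∑ {k} (λ _ → 1ℚ)))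
      (ℚₚ.≤-reflexive (trans (cong (λ z → K - z) (∑-1 k)) (ℚₚ.+-inverseʳ K)))
    term false = ℚₚ.≤-trans (tent≤ˡ (∑ {k} (λ _ → 0ℚ))) (ℚₚ.≤-reflexive ∑0)
    pointwise : ∀ ℓ → lineTerm E (λ _ → i) i ℓ ≤ 0ℚ
    pointwise ℓ = term (does (i ≟ᶠ ℓ))
  columnBound : ∀ i → lineCost E (λ j → j) i ≤ E
  columnBound i = subst (lineCost E (λ j → j) i ≤_)
    (trans (∑-distrib-+ (λ _ → 1ℚ) (λ ℓ → δ i ℓ * (E - K)))
      (trans (cong₂ _+_ (∑-1 k) (∑-δ i (λ _ → E - K))) (alg K E)))
    (∑-mono pointwise)
    where
    alg : ∀ K E → K + (E - K) ≡ E
    alg = solve-∀ ringℚ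
    one : ∀ ℓ → count (λ j → j) ℓ ≡ 1ℚ
    one ℓ = trans (sum-cong-≗ (λ j → δ-sym j ℓ)) (∑-δ1 ℓ)
    term : ∀ b a → a ≡ 1ℚ → (if b then tent E (K - a) else tent E a) ≤ 1ℚ + 𝟙 b * (E - K)
    term true  .1ℚ refl = ℚₚ.≤-trans (tent≤ʳ (K - 1ℚ)) (ℚₚ.≤-reflexive (alg′ K E))
      where
      alg′ : ∀ K E → E - (K - 1ℚ) ≡ 1ℚ + 1ℚ * (E - K)
      alg′ = solve-∀ ringℚ
    term false .1ℚ refl = ℚₚ.≤-trans (tent≤ˡ 1ℚ) (ℚₚ.≤-reflexive (alg′ (E - K)))
      where
      alg′ : ∀ z → 1ℚ ≡ 1ℚ + 0ℚ * z
      alg′ = solve-∀ ringℚ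
    pointwise : ∀ ℓ → lineTerm E (λ j → j) i ℓ ≤ 1ℚ + δ i ℓ * (E - K)
    pointwise ℓ = term (does (i ≟ᶠ ℓ)) (count (λ j → j) ℓ) (one ℓ)
  rows : ∑ {k} (λ i → lineCost E (λ _ → i) i) ≤ 0ℚ
  rows = ℚₚ.≤-trans (∑-mono {k} {λ i → lineCost E (λ _ → i) i} {λ _ → 0ℚ} rowBound) (ℚₚ.≤-reflexive ∑0)
  columns : ∑ {k} (lineCost E (λ j → j)) ≤ K * E
  columns = ℚₚ.≤-trans (∑-mono {k} {lineCost E (λ j → j)} {λ _ → E} columnBound) (ℚₚ.≤-reflexive (∑-const k E))

-- Lower bound for symmetric assignments

module _ {k : ℕ} {γ H : ℚ} (γ≡ : γ ≡ fromℕ 2 * H) (0≤H : 0ℚ ≤ H) (2H≤K : H + H ≤ fromℕ k)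
         (A : Assignment k) (A-sym : Symmetric A) where

  private
    K = fromℕ k
    E = (K - H) + (K - H)
    L = label A
    c : Fin k → ℚ
    c i = lineCost E (L i) i

  saving : Kind k → Fin k → ℚ
  saving κ i = ∑ (λ j → weight κ i (L i j)) + H * (isOther κ - isOwn κ)

  -- The alternatives of `LineBound` become the kinds `own`, `plain` and `other ℓ`, with half
  -- savings a i - H, 0 and a ℓ - (K - H).
  lineCost-saving : ∀ i → ∃[ κ ] E ≤ c i + (saving κ i + saving κ i)
  lineCost-saving i = kinds (lineCost-bound H 2H≤K (L i) i)
   where
   kinds : LineBound H 2H≤K (L i) i (c i) → ∃[ κ ] E ≤ c i + (saving κ i + saving κ i)
   kinds (inj₁ h) = own , ≤-by (≤⇒0≤- h) (alg K H (count (L i) i) (c i))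
     where
     alg : ∀ K H a c → c - ((K - a) + (K - a))
           ≡ c + ((a + H * (0ℚ - 1ℚ)) + (a + H * (0ℚ - 1ℚ))) - ((K - H) + (K - H))
     alg = solve-∀ ringℚ
   kinds (inj₂ (inj₁ h)) = plain , subst (λ z → E ≤ c i + ((z + H * (0ℚ - 0ℚ)) + (z + H * (0ℚ - 0ℚ))))
         (sym (trans (∑-const k 0ℚ) (ℚₚ.*-zeroʳ K))) (≤-by (≤⇒0≤- h) (alg E H (c i)))
     where
     alg : ∀ E H c → c - E ≡ c + ((0ℚ + H * (0ℚ - 0ℚ)) + (0ℚ + H * (0ℚ - 0ℚ))) - E
     alg = solve-∀ ringℚ
   kinds (inj₂ (inj₂ (ℓ , _ , h))) = other ℓ , subst (λ z → E ≤ c i + ((z + H * (1ℚ - 0ℚ)) + (z + H * (1ℚ - 0ℚ))))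
         (sym sum-1) (≤-by (≤⇒0≤- h) (alg K H (count (L i) ℓ) (c i)))
     where
     sum-1 : ∑ (λ j → δ (L i j) ℓ - 1ℚ) ≡ count (L i) ℓ + K * - 1ℚ
     sum-1 = trans (∑-distrib-+ (λ j → δ (L i j) ℓ) (λ _ → - 1ℚ)) (cong (λ z → count (L i) ℓ + z) (∑-const k (- 1ℚ)))
     alg : ∀ K H a c → c - (((K - H) + (K - H) - a) + ((K - H) + (K - H) - a))
           ≡ c + (((a + K * - 1ℚ) + H * (1ℚ - 0ℚ)) + ((a + K * - 1ℚ) + H * (1ℚ - 0ℚ))) - ((K - H) + (K - H))
     alg = solve-∀ ringℚ

  private
    κ : Fin k → Kind k
    κ i = proj₁ (lineCost-saving i)
    P = ∑ (isOwn ∘ κ)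
    Q = ∑ (isOther ∘ κ)
    W = ∑ λ i → ∑ λ j → weight (κ i) i (L i j)

    ∑-saving : ∑ (λ i → saving (κ i) i) ≡ W + H * (Q - P)
    ∑-saving = trans (∑-distrib-+ (λ i → ∑ (λ j → weight (κ i) i (L i j))) (λ i → H * (isOther (κ i) - isOwn (κ i))))
      (cong (λ z → W + z) (trans (sym (*-distribˡ-sum H (λ i → isOther (κ i) - isOwn (κ i)))) (cong (λ z → H * z)
        (trans (∑-distrib-+ (isOther ∘ κ) (λ i → - isOwn (κ i))) (cong (λ z → Q + z) neg)))))
      where
      neg : ∑ (λ i → - isOwn (κ i)) ≡ - P
      neg = trans (sum-cong-≗ (λ i → alg (isOwn (κ i)))) (trans (sym (*-distribˡ-sum (- 1ℚ) (isOwn ∘ κ))) (sym (alg P)))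
        where
        alg : ∀ z → - z ≡ - 1ℚ * z
        alg = solve-∀ ringℚ

    lines : K * E ≤ ∑ c + ((W + H * (Q - P)) + (W + H * (Q - P)))
    lines = subst₂ _≤_ (∑-const k E)
      (trans (∑-distrib-+ c (λ i → saving (κ i) i + saving (κ i) i))
        (cong (λ z → ∑ c + z) (trans (∑-distrib-+ (λ i → saving (κ i) i) (λ i → saving (κ i) i))
          (cong₂ _+_ ∑-saving ∑-saving))))
      (∑-mono (λ i → proj₂ (lineCost-saving i)))

    cost-double : cost γ A ≡ ∑ c + ∑ c
    cost-double = trans (cost-lines A γ≡) (cong (λ z → ∑ c + z)
      (sum-cong-≗ λ i → sum-cong-≗ λ ℓ →
        lineTerm-cong ℓ i (sum-cong-≗ λ j → cong (λ m → δ m ℓ) (label-sym A A-sym j i))))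
      where
      lineTerm-cong : ∀ ℓ i → count (λ j → L j i) ℓ ≡ count (L i) ℓ →
                      lineTerm E (λ j → L j i) i ℓ ≡ lineTerm E (L i) i ℓ
      lineTerm-cong ℓ i eq = cong (λ a → if does (i ≟ᶠ ℓ) then tent E (K - a) else tent E a) eq

    double : ∀ {M} → (W + H * (Q - P)) + (W + H * (Q - P)) ≤ M → K * E + K * E ≤ cost γ A + (M + M)
    double {M} h = subst (λ z → K * E + K * E ≤ z + (M + M)) (sym cost-double)
      (≤-by (0≤+ (0≤+ l l) (0≤+ m m)) (alg (K * E) (∑ c) ((W + H * (Q - P)) + (W + H * (Q - P))) M))
      where
      l = ≤⇒0≤- lines
      m = ≤⇒0≤- h
      alg : ∀ e c s M → ((c + s - e) + (c + s - e)) + ((M - s) + (M - s)) ≡ c + c + (M + M) - (e + e)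
      alg = solve-∀ ringℚ

  symmetric-cost : let M₁ = fromℕ 2 * K * H + fromℕ 3 * K; M₂ = (K - H) * (K - H) + fromℕ 3 * K in
                   K * E + K * E ≤ cost γ A + (M₁ + M₁) ⊎ K * E + K * E ≤ cost γ A + (M₂ + M₂)
  symmetric-cost = ⊎-map double double (∑-weight-cases L (label-sym A A-sym) κ 0≤H)

-- Arithmetic of the ratio

5/4ℚ : ℚ
5/4ℚ = + 5 / 4

private
  0<2 : 0ℚ < fromℕ 2
  0<2 = ℚₚ.positive⁻¹ (fromℕ 2)

-- Here `Z` stands for √(3k² - 2k) rounded up. Otherwise (sK - 2)² ≥ Z², whereas (sK - 2)² ≤ 3K² -
-- 4sK + 4 ≤ Z² + 2K - 5K + 4 ≤ Z² - 2.
√3-scaled-bound : ∀ {s K Z} → 5/4ℚ ≤ s → s * s ≤ fromℕ 3 → fromℕ 2 ≤ K → 0ℚ ≤ Z →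
                  fromℕ 3 * (K * K) ≤ Z * Z + fromℕ 2 * K → s * K ≤ Z + fromℕ 2
√3-scaled-bound {s} {K} {Z} 5/4≤s s²≤3 2≤K 0≤Z Z² = ℚₚ.≮⇒≥ λ lt →
  let 0≤gap = ≤⇒0≤- (ℚₚ.<⇒≤ lt) in
  <⇒≱ {0ℚ} {fromℕ 2} 0<2 (≤-by
    (0≤+ (0≤+ (0≤+ (0≤+ (0≤* 0≤gap (0≤+ (0≤+ 0≤gap 0≤Z) 0≤Z)) (0≤* (0≤square K) (≤⇒0≤- s²≤3))) (≤⇒0≤- Z²))
      (0≤* (0≤* (0≤fromℕ 4) 0≤K) (≤⇒0≤- 5/4≤s))) (0≤* (0≤fromℕ 3) (≤⇒0≤- 2≤K)))
    (alg s K Z))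
  where
  0≤K = ℚₚ.≤-trans (ℚₚ.<⇒≤ 0<2) 2≤K
  alg : ∀ s K Z →
    (s * K - (Z + fromℕ 2)) * ((s * K - (Z + fromℕ 2)) + Z + Z) + (K * K) * (fromℕ 3 - s * s)
      + ((Z * Z + fromℕ 2 * K) - fromℕ 3 * (K * K)) + fromℕ 4 * K * (s - 5/4ℚ) + fromℕ 3 * (K - fromℕ 2)
    ≡ 0ℚ - fromℕ 2
  alg = solve-∀ ringℚ

-- An equality at the ideal values s = √3 and r = √3 K. Both are approximated from below and either
-- may be the worse one, hence the comparison of `r` with sK. In the second case a factor `K` is
-- added so that the bound on r² applies.
√3-product-bound : ∀ {s K r} → 1ℚ ≤ s → s * s ≤ fromℕ 3 → 0ℚ < K → 0ℚ ≤ r → r * r ≤ fromℕ 3 * (K * K) →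
                   s * r + s * K - r ≤ fromℕ 3 * K
√3-product-bound {s} {K} {r} 1≤s s²≤3 0<K 0≤r r² with ℚₚ.≤-total r (s * K)
... | inj₁ r≤sK = ≤-by (0≤+ (0≤* (ℚₚ.<⇒≤ 0<K) (≤⇒0≤- s²≤3)) (0≤* (≤⇒0≤- 1≤s) (≤⇒0≤- r≤sK))) (alg s K r)
  where
  alg : ∀ s K r → K * (fromℕ 3 - s * s) + (s - 1ℚ) * (s * K - r) ≡ fromℕ 3 * K - (s * r + s * K - r)
  alg = solve-∀ ringℚ
... | inj₂ sK≤r = ℚₚ.*-cancelʳ-≤-pos K {{ℚ.positive 0<K}}
        (≤-by (0≤+ (≤⇒0≤- r²) (0≤* (0≤+ 0≤r (ℚₚ.<⇒≤ 0<K)) (≤⇒0≤- sK≤r))) (alg s K r))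
  where
  alg : ∀ s K r → (fromℕ 3 * (K * K) - r * r) + (r + K) * (r - s * K) ≡ fromℕ 3 * K * K - (s * r + s * K - r) * K
  alg = solve-∀ ringℚ

-- If 2H ≥ K + 1, then 4Z² ≤ (3K - 1)², but 4Z² ≥ 12K² - 8K, which is impossible for K ≥ 2. For
-- integers the excluded inequality is the negation of 2H ≤ K.
half-bound : ∀ {H K Z} → fromℕ 2 ≤ K → H + Z ≡ fromℕ 2 * K → 0ℚ ≤ Z →
             fromℕ 3 * (K * K) ≤ Z * Z + fromℕ 2 * K → ¬ K + 1ℚ ≤ H + H
half-bound {H} {K} {Z} 2≤K H+Z 0≤Z Z² h = <⇒≱ {0ℚ} {fromℕ 2} 0<2 (≤-by
  (0≤+ (0≤+ (0≤+ (0≤* 0≤gap (0≤+ 0≤gap (0≤* (0≤fromℕ 4) 0≤Z))) (0≤* (0≤fromℕ 4) (≤⇒0≤- Z²)))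
    (0≤+ (0≤* (0≤* (0≤fromℕ 3) 0≤K) (≤⇒0≤- 2≤K)) (0≤* (0≤fromℕ 4) (≤⇒0≤- 2≤K)))) (0≤fromℕ 5))
  (alg K Z))
  where
  0≤K = ℚₚ.≤-trans (ℚₚ.<⇒≤ 0<2) 2≤K
  H≡ : ∀ H Z → H ≡ H + Z - Z
  H≡ = solve-∀ ringℚ
  0≤gap : 0ℚ ≤ fromℕ 3 * K - 1ℚ - fromℕ 2 * Z
  0≤gap = subst (0ℚ ≤_) (alg₁ K Z) (≤⇒0≤- (subst (λ z → K + 1ℚ ≤ z + z) (trans (H≡ H Z) (cong (λ z → z - Z) H+Z)) h))
    where
    alg₁ : ∀ K Z → (fromℕ 2 * K - Z) + (fromℕ 2 * K - Z) - (K + 1ℚ) ≡ fromℕ 3 * K - 1ℚ - fromℕ 2 * Z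
    alg₁ = solve-∀ ringℚ
  alg : ∀ K Z → (fromℕ 3 * K - 1ℚ - fromℕ 2 * Z) * ((fromℕ 3 * K - 1ℚ - fromℕ 2 * Z) + fromℕ 4 * Z)
      + fromℕ 4 * ((Z * Z + fromℕ 2 * K) - fromℕ 3 * (K * K))
      + (fromℕ 3 * K * (K - fromℕ 2) + fromℕ 4 * (K - fromℕ 2)) + fromℕ 5
    ≡ 0ℚ - fromℕ 2
  alg = solve-∀ ringℚ

module _ {s K H Z r : ℚ} (5/4≤s : 5/4ℚ ≤ s) (s²≤3 : s * s ≤ fromℕ 3) (2≤K : fromℕ 2 ≤ K)
         (H+Z : H + Z ≡ fromℕ 2 * K) (2H≤K : H + H ≤ K) (0≤Z : 0ℚ ≤ Z)
         (Z² : fromℕ 3 * (K * K) ≤ Z * Z + fromℕ 2 * K)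
         (Z≤r+1 : Z ≤ r + 1ℚ) (0≤r : 0ℚ ≤ r) (r² : r * r ≤ fromℕ 3 * (K * K)) where

  private
    W = K - H
    0<K = ℚₚ.<-≤-trans 0<2 2≤K
    0≤K = ℚₚ.<⇒≤ 0<K
    1≤s : 1ℚ ≤ s
    1≤s = ℚₚ.≤-trans (ℚₚ.≤ᵇ⇒≤ {1ℚ} {5/4ℚ} _) 5/4≤s
    0≤s-1 = ≤⇒0≤- 1≤s
    0≤K-2H = ≤⇒0≤- 2H≤K
    Z≡ : Z ≡ fromℕ 2 * K - H
    Z≡ = trans (alg H Z) (cong (λ z → z - H) H+Z)
      where
      alg : ∀ H Z → Z ≡ H + Z - H
      alg = solve-∀ ringℚ
    0≤W : 0ℚ ≤ W + W
    0≤W = subst (0ℚ ≤_) (alg K H) (0≤+ 0≤K 0≤K-2H)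
      where
      alg : ∀ K H → K + (K - (H + H)) ≡ (K - H) + (K - H)
      alg = solve-∀ ringℚ

  -- The quadratic part of the difference is 4K((2 - s)K - H), so `H` must not be too large;
  -- `√3-scaled-bound` makes this at least -8K. The constant 76 arises as follows: 76W ≥ 38K, of
  -- which 6K pays for the linear part of M + M, and 32(s - 1)K ≥ 8K since s ≥ 5/4.
  ratio-slack₁ : let M = fromℕ 2 * K * H + fromℕ 3 * K in
    (fromℕ 8 * s - fromℕ 12) * (K * W) + (s - 1ℚ) * (M + M)
      ≤ (s - 1ℚ) * (fromℕ 76 * W + fromℕ 4 * (K * W))
  ratio-slack₁ = ≤-by
    (0≤+ (0≤+ (0≤* (0≤* (0≤fromℕ 4) 0≤K) 0≤gap) (0≤* 0≤s-1 (0≤* (0≤fromℕ 38) 0≤K-2H)))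
      (0≤* (0≤* (0≤fromℕ 32) 0≤K) (≤⇒0≤- 5/4≤s)))
    (alg s K H)
    where
    0≤gap : 0ℚ ≤ fromℕ 2 * K - H + fromℕ 2 - s * K
    0≤gap = subst (λ z → 0ℚ ≤ z + fromℕ 2 - s * K) Z≡ (≤⇒0≤- (√3-scaled-bound 5/4≤s s²≤3 2≤K 0≤Z Z²))
    alg : ∀ s K H →
      fromℕ 4 * K * (fromℕ 2 * K - H + fromℕ 2 - s * K) + (s - 1ℚ) * (fromℕ 38 * (K - (H + H)))
        + fromℕ 32 * K * (s - 5/4ℚ)
      ≡ (s - 1ℚ) * (fromℕ 76 * (K - H) + fromℕ 4 * (K * (K - H)))
        - ((fromℕ 8 * s - fromℕ 12) * (K * (K - H))
           + (s - 1ℚ) * ((fromℕ 2 * K * H + fromℕ 3 * K) + (fromℕ 2 * K * H + fromℕ 3 * K)))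
    alg = solve-∀ ringℚ

  -- Here `H` must not be too small, which is what 2K - H ≤ r + 1 says. Adding `√3-product-bound`
  -- eliminates `r`, and the rounding error 2W(s - 1) is linear.
  ratio-slack₂ : let M = W * W + fromℕ 3 * K in
    (fromℕ 8 * s - fromℕ 12) * (K * W) + (s - 1ℚ) * (M + M)
      ≤ (s - 1ℚ) * (fromℕ 76 * W + fromℕ 4 * (K * W))
  ratio-slack₂ = ≤-by
    (0≤+ (0≤+ (0≤* 0≤s-1 (0≤+ (0≤* (0≤fromℕ 31) 0≤K) (0≤* (0≤fromℕ 37) 0≤K-2H)))
      (0≤* 0≤W (0≤* 0≤s-1 0≤gap))) (0≤* 0≤W 0≤t))
    (alg s K H r)
    where
    0≤gap : 0ℚ ≤ r + 1ℚ - (fromℕ 2 * K - H)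
    0≤gap = subst (λ z → 0ℚ ≤ r + 1ℚ - z) Z≡ (≤⇒0≤- Z≤r+1)
    0≤t : 0ℚ ≤ fromℕ 3 * K - (s * r + s * K - r)
    0≤t = ≤⇒0≤- (√3-product-bound 1≤s s²≤3 0<K 0≤r r²)
    alg : ∀ s K H r →
      (s - 1ℚ) * (fromℕ 31 * K + fromℕ 37 * (K - (H + H)))
        + ((K - H) + (K - H)) * ((s - 1ℚ) * (r + 1ℚ - (fromℕ 2 * K - H)))
        + ((K - H) + (K - H)) * (fromℕ 3 * K - (s * r + s * K - r))
      ≡ (s - 1ℚ) * (fromℕ 76 * (K - H) + fromℕ 4 * (K * (K - H)))
        - ((fromℕ 8 * s - fromℕ 12) * (K * (K - H))
           + (s - 1ℚ) * (((K - H) * (K - H) + fromℕ 3 * K) + ((K - H) * (K - H) + fromℕ 3 * K)))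
    alg = solve-∀ ringℚ

  -- With X the symmetric optimum and M the bound on the savings, ρ ≥ X / (2k(k − h)).
  ratio-bound : ∀ {X ρ κ M} → κ * K ≡ 1ℚ → K * (W + W) + K * (W + W) ≤ X + (M + M) → X ≤ ρ * (K * (W + W)) →
    (fromℕ 8 * s - fromℕ 12) * (K * W) + (s - 1ℚ) * (M + M)
      ≤ (s - 1ℚ) * (fromℕ 76 * W + fromℕ 4 * (K * W)) →
    fromℕ 8 * s - fromℕ 12 ≤ (fromℕ 2 * s - fromℕ 2) * (ρ + fromℕ 38 * κ)
  ratio-bound {X} {ρ} {κ} {M} κK≡1 hM hX slack = ℚₚ.*-cancelʳ-≤-pos (K * W) {{ℚ.positive 0<KW}} (≤-by
    (0≤+ (≤⇒0≤- slack) (0≤* 0≤s-1 (0≤+ (≤⇒0≤- hM) (≤⇒0≤- hX))))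
    (trans (alg s K W X ρ M) (trans
      (cong (λ z → (fromℕ 2 * s - fromℕ 2) * (ρ * (K * W) + fromℕ 38 * z * W) - (fromℕ 8 * s - fromℕ 12) * (K * W))
        (sym κK≡1))
      (alg′ s K W ρ κ))))
    where
    0<W : 0ℚ < W
    0<W = ℚₚ.*-cancelˡ-<-nonNeg (fromℕ 2) (ℚₚ.<-≤-trans 0<K (≤-by 0≤K-2H (algW K H)))
      where
      algW : ∀ K H → K - (H + H) ≡ fromℕ 2 * (K - H) - K
      algW = solve-∀ ringℚ
    0<KW : 0ℚ < K * W
    0<KW = ℚₚ.positive⁻¹ (K * W) {{ℚₚ.pos*pos⇒pos K {{ℚ.positive 0<K}} W {{ℚ.positive 0<W}}}}
    alg : ∀ s K W X ρ M →
      ((s - 1ℚ) * (fromℕ 76 * W + fromℕ 4 * (K * W)) - ((fromℕ 8 * s - fromℕ 12) * (K * W) + (s - 1ℚ) * (M + M)))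
        + (s - 1ℚ) * ((X + (M + M) - (K * (W + W) + K * (W + W))) + (ρ * (K * (W + W)) - X))
      ≡ (fromℕ 2 * s - fromℕ 2) * (ρ * (K * W) + fromℕ 38 * 1ℚ * W) - (fromℕ 8 * s - fromℕ 12) * (K * W)
    alg = solve-∀ ringℚ
    alg′ : ∀ s K W ρ κ →
      (fromℕ 2 * s - fromℕ 2) * (ρ * (K * W) + fromℕ 38 * (κ * K) * W) - (fromℕ 8 * s - fromℕ 12) * (K * W)
      ≡ (fromℕ 2 * s - fromℕ 2) * (ρ + fromℕ 38 * κ) * (K * W) - (fromℕ 8 * s - fromℕ 12) * (K * W)
    alg′ = solve-∀ ringℚ

-- Square roots and the floor

/-*-cancel : ∀ a n → (+ a / suc n) * fromℕ (suc n) ≡ fromℕ a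
/-*-cancel a n = ℚₚ.toℚᵘ-injective
  (ℚᵘₚ.≃-trans (ℚₚ.toℚᵘ-homo-* (+ a / suc n) (fromℕ (suc n)))
  (ℚᵘₚ.≃-trans (ℚᵘₚ.*-cong (ℚₚ.toℚᵘ-fromℚᵘ (ℚᵘ.mkℚᵘ (+ a) n)) (ℚₚ.toℚᵘ-fromℚᵘ (ℚᵘ.mkℚᵘ (+ suc n) 0)))
  (ℚᵘₚ.≃-trans (ℚᵘ.*≡* eq) (ℚᵘₚ.≃-sym (ℚₚ.toℚᵘ-fromℚᵘ (ℚᵘ.mkℚᵘ (+ a) 0))))))
  where
  eq : (+ a ℤ.* + suc n) ℤ.* + 1 ≡ + a ℤ.* + (suc n ℕ.* 1)
  eq = trans (ℤₚ.*-identityʳ (+ a ℤ.* + suc n)) (cong (λ z → + a ℤ.* + z) (sym (ℕₚ.*-identityʳ (suc n))))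

0<fromℕ-suc : ∀ n → 0ℚ < fromℕ (suc n)
0<fromℕ-suc n = ℚₚ.<-≤-trans (ℚₚ.positive⁻¹ 1ℚ) (fromℕ-mono {1} {suc n} (ℕ.s≤s ℕ.z≤n))

0≤√-seq : ∀ m n → 0ℚ ≤ √-seq m n
0≤√-seq m n = ℚₚ.*-cancelʳ-≤-pos (fromℕ (suc n)) {{ℚ.positive (0<fromℕ-suc n)}}
  (subst₂ _≤_ (sym (ℚₚ.*-zeroˡ (fromℕ (suc n)))) (sym (/-*-cancel a n)) (0≤fromℕ a))
  where a = isqrt (m ℕ.* (suc n ℕ.* suc n))

√-seq-square : ∀ m n → √-seq m n * √-seq m n ≤ fromℕ m
√-seq-square m n = ℚₚ.*-cancelʳ-≤-pos (l * l) {{ℚₚ.pos*pos⇒pos l l}}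
  (subst₂ _≤_ lhs rhs (fromℕ-mono (isqrt-lower (m ℕ.* (suc n ℕ.* suc n)))))
  where
  l = fromℕ (suc n)
  instance _ = ℚ.positive (0<fromℕ-suc n)
  s = √-seq m n
  a = isqrt (m ℕ.* (suc n ℕ.* suc n))
  alg : ∀ s l → s * l * (s * l) ≡ s * s * (l * l)
  alg = solve-∀ ringℚ
  lhs : fromℕ (a ℕ.* a) ≡ s * s * (l * l)
  lhs = trans (fromℕ-* a a) (trans (cong₂ _*_ (sym (/-*-cancel a n)) (sym (/-*-cancel a n))) (alg s l))
  rhs : fromℕ (m ℕ.* (suc n ℕ.* suc n)) ≡ fromℕ m * (l * l)
  rhs = trans (fromℕ-* m (suc n ℕ.* suc n)) (cong (λ z → fromℕ m * z) (fromℕ-* (suc n) (suc n)))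

isqrt-max : ∀ {r n} → r ℕ.* r ℕ.≤ n → r ℕ.≤ isqrt n
isqrt-max {r} {n} r²≤n = ℕₚ.≮⇒≥ λ lt → ℕₚ.<⇒≱ (isqrt-upper n) (ℕₚ.≤-trans (ℕₚ.*-mono-≤ lt lt) r²≤n)

-- If m > z² then √m ≥ z + 1/l for l = 2z + 1, since (zl + 1)² ≤ (z² + 1) l²; the terms of √-seq at
-- multiples of l see this gap exactly.
≤-√-square : ∀ m z → (∀ ε → 0ℚ < ε → ∃[ N ] (∀ n → N ℕ.≤ n → √-seq m n ≤ fromℕ z + ε)) → m ℕ.≤ z ℕ.* z
≤-√-square m z h = ℕₚ.≮⇒≥ λ z²<m → gap z²<m (h ε 0<ε)
  where
  l′ = z ℕ.+ z
  l = suc l′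
  -- Strictly smaller than the gap 1/l.
  ε = + 1 / suc l
  ε*l+1 : ε * fromℕ (suc l) ≡ 1ℚ
  ε*l+1 = /-*-cancel 1 l
  0<ε : 0ℚ < ε
  0<ε = ℚₚ.*-cancelʳ-<-nonNeg (fromℕ (suc l)) {{ℚ.nonNegative (0≤fromℕ (suc l))}}
    (subst₂ _<_ (sym (ℚₚ.*-zeroˡ (fromℕ (suc l)))) (sym ε*l+1) (ℚₚ.positive⁻¹ 1ℚ))
  gap : z ℕ.* z ℕ.< m → ¬ (∃[ N ] (∀ n → N ℕ.≤ n → √-seq m n ≤ fromℕ z + ε))
  gap z²<m (N , hN) = <⇒≱ {0ℚ} {C * ε} 0<Cε (≤-by
    (0≤+ (0≤* (ℚₚ.<⇒≤ 0<Cl) (≤⇒0≤- s≤)) (≤⇒0≤- ≤sCl)) (trans (alg C Lℚ ε Z s)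
      (trans (cong (λ t → C * (t - 1ℚ) + (0ℚ - C * ε)) ε1) (alg₀ C (C * ε)))))
    where
    c = suc N
    -- Chosen so that `suc j` is definitionally `c ℕ.* l`.
    j = l′ ℕ.+ N ℕ.* l
    C = fromℕ c
    Lℚ = fromℕ l
    Z = fromℕ z
    s = √-seq m j
    b = isqrt (m ℕ.* (suc j ℕ.* suc j))
    N≤j : N ℕ.≤ j
    N≤j = ℕₚ.≤-trans (ℕₚ.m≤m*n N l) (ℕₚ.m≤n+m (N ℕ.* l) l′)
    s≤ : s ≤ Z + ε
    s≤ = hN j N≤j
    below : c ℕ.* (z ℕ.* l ℕ.+ 1) ℕ.≤ b
    below = isqrt-max (begin
      c ℕ.* (z ℕ.* l ℕ.+ 1) ℕ.* (c ℕ.* (z ℕ.* l ℕ.+ 1))  ≤⟨ ℕₚ.m≤m+n _ _ ⟩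
      c ℕ.* (z ℕ.* l ℕ.+ 1) ℕ.* (c ℕ.* (z ℕ.* l ℕ.+ 1)) ℕ.+ c ℕ.* c ℕ.* (z ℕ.+ z)
                                                        ≡⟨ expand c z ⟩
      suc (z ℕ.* z) ℕ.* (c ℕ.* l ℕ.* (c ℕ.* l))           ≤⟨ ℕₚ.*-monoˡ-≤ (c ℕ.* l ℕ.* (c ℕ.* l)) z²<m ⟩
      m ℕ.* (suc j ℕ.* suc j)                           ∎)
      where
      open ℕₚ.≤-Reasoning
      expand : ∀ c z → c ℕ.* (z ℕ.* suc (z ℕ.+ z) ℕ.+ 1) ℕ.* (c ℕ.* (z ℕ.* suc (z ℕ.+ z) ℕ.+ 1)) ℕ.+ c ℕ.* c ℕ.* (z ℕ.+ z)
                     ≡ suc (z ℕ.* z) ℕ.* (c ℕ.* suc (z ℕ.+ z) ℕ.* (c ℕ.* suc (z ℕ.+ z)))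
      expand = solveℕ-∀
    ≤sCl : C * (Z * Lℚ + 1ℚ) ≤ s * (C * Lℚ)
    ≤sCl = subst₂ _≤_
      (trans (fromℕ-* c (z ℕ.* l ℕ.+ 1)) (cong (λ t → C * t)
        (trans (fromℕ-+ (z ℕ.* l) 1) (cong (λ t → t + 1ℚ) (fromℕ-* z l)))))
      (trans (sym (/-*-cancel b j)) (cong (λ t → s * t) (fromℕ-* c l)))
      (fromℕ-mono below)
    0<C = 0<fromℕ-suc N
    0<Cl : 0ℚ < C * Lℚ
    0<Cl = ℚₚ.positive⁻¹ (C * Lℚ) {{ℚₚ.pos*pos⇒pos C {{ℚ.positive 0<C}} Lℚ {{ℚ.positive (0<fromℕ-suc l′)}}}}
    0<Cε : 0ℚ < C * ε
    0<Cε = ℚₚ.positive⁻¹ (C * ε) {{ℚₚ.pos*pos⇒pos C {{ℚ.positive 0<C}} ε {{ℚ.positive 0<ε}}}}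
    ε1 : ε * (1ℚ + Lℚ) ≡ 1ℚ
    ε1 = trans (cong (λ t → ε * t) (sym (fromℕ-+ 1 l))) ε*l+1
    alg : ∀ C l e Z s → C * l * (Z + e - s) + (s * (C * l) - C * (Z * l + 1ℚ))
                        ≡ C * (e * (1ℚ + l) - 1ℚ) + (0ℚ - C * e)
    alg = solve-∀ ringℚ
    alg₀ : ∀ C t → C * (1ℚ - 1ℚ) + (0ℚ - t) ≡ 0ℚ - t
    alg₀ = solve-∀ ringℚ

-- Replaces the floor of a real by integer inequalities: `z`, that is 2k - h, is √m rounded up. The
-- number `r` is the term of `√-seq` at index 0, whence the factor 1.
floor-√ : ∀ k m h → let r = isqrt (m ℕ.* 1) in r ℕ.< 2 ℕ.* k →
          IsFloor (ιℕ 2 *ᴿ ιℕ k -ᴿ √ m) h →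
          ∃[ n ] ∃[ z ] (h ≡ + n × n ℕ.+ z ≡ 2 ℕ.* k × m ℕ.≤ z ℕ.* z × z ℕ.≤ suc r)
floor-√ k m h r<2k (lower , upper) = result h lower (strict upper)
  where
  r = isqrt (m ℕ.* 1)
  K2 = fromℕ 2 * fromℕ k
  K2≡ : fromℕ (2 ℕ.* k) ≡ K2
  K2≡ = fromℕ-* 2 k
  -- Every term of `√-seq m` is at most r + 1, by `√-close` against index 0.
  strict : (ιℕ 2 *ᴿ ιℕ k -ᴿ √ m) <ᴿ ι (fromℤ (h ℤ.+ ℤ.1ℤ)) → K2 < fromℤ h + fromℕ (suc (suc r))
  strict (ε , 0<ε , N , hN) = ℚₚ.<-≤-trans (K2<K2+ε ε 0<ε) (≤-by
        (0≤+ (≤⇒0≤- (hN N ℕₚ.≤-refl)) (≤⇒0≤- (√-close m N 0)))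
        (trans (cong (λ t → t - (K2 + - √-seq m N + ε) + (fromℕ r + 1ℚ - √-seq m N)) (fromℤ-+ h ℤ.1ℤ))
        (trans (alg (fromℤ h) K2 (√-seq m N) ε (fromℕ r))
          (cong (λ t → fromℤ h + t - (K2 + ε)) (sym (fromℕ-+ 2 r))))))
    where
    K2<K2+ε : ∀ ε → 0ℚ < ε → K2 < K2 + ε
    K2<K2+ε ε 0<ε = subst (_< K2 + ε) (ℚₚ.+-identityʳ K2) (ℚₚ.+-monoʳ-< K2 0<ε)
    alg : ∀ h K s e r → (h + 1ℚ) - (K + - s + e) + (r + 1ℚ - s) ≡ h + (fromℕ 2 + r) - (K + e)
    alg = solve-∀ ringℚ

  result : ∀ h → ι (fromℤ h) ≤ᴿ (ιℕ 2 *ᴿ ιℕ k -ᴿ √ m) → K2 < fromℤ h + fromℕ (suc (suc r)) →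
           ∃[ n ] ∃[ z ] (h ≡ + n × n ℕ.+ z ≡ 2 ℕ.* k × m ℕ.≤ z ℕ.* z × z ℕ.≤ suc r)
  -- A negative floor would give 2k < r + 1 ≤ 2k.
  result ℤ.-[1+ n ] _ lt = contradiction (ℚₚ.<-≤-trans lt (≤-by
      (0≤+ (≤⇒0≤- (fromℤ-mono { ℤ.-[1+ n ]} { ℤ.-[1+ 0 ]} (ℤ.-≤- ℕ.z≤n))) (≤⇒0≤- r+1≤))
      (trans (alg (fromℤ ℤ.-[1+ n ]) (fromℕ (suc r)) K2)
        (cong (λ t → K2 - (fromℤ ℤ.-[1+ n ] + t)) (sym (fromℕ-+ 1 (suc r)))))))
      (ℚₚ.<-irrefl refl)
    where
    r+1≤ : fromℕ (suc r) ≤ K2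
    r+1≤ = subst (fromℕ (suc r) ≤_) K2≡ (fromℕ-mono {suc r} {2 ℕ.* k} r<2k)
    alg : ∀ h r K → (- 1ℚ - h) + (K - r) ≡ K - (h + (1ℚ + r))
    alg = solve-∀ ringℚ
  result (+ n) low lt = n , z , refl , n+z , ≤-√-square m z approx , z≤
    where
    z = 2 ℕ.* k ℕ.∸ n
    -- Rules out truncation in `z`. As n and 2k are integers and the terms of `√-seq` are
    -- nonnegative, the error ½ is small enough.
    n≤2k : n ℕ.≤ 2 ℕ.* k
    n≤2k = ℕₚ.≮⇒≥ λ 2k<n → absurd 2k<n (low ½ (ℚₚ.positive⁻¹ ½))
      where
      absurd : 2 ℕ.* k ℕ.< n → ¬ (∃[ N ] (∀ i → N ℕ.≤ i → fromℕ n ≤ K2 + - √-seq m i + ½))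
      absurd 2k<n (N , hN) = <⇒≱ {0ℚ} {½} (ℚₚ.positive⁻¹ ½) (≤-by
        (0≤+ (0≤+ (≤⇒0≤- (hN N ℕₚ.≤-refl)) (0≤√-seq m N)) (≤⇒0≤- 1+K2≤n)) (alg (fromℕ n) K2 (√-seq m N)))
        where
        1+K2≤n : 1ℚ + K2 ≤ fromℕ n
        1+K2≤n = subst (_≤ fromℕ n) (trans (fromℕ-+ 1 (2 ℕ.* k)) (cong (λ t → 1ℚ + t) K2≡)) (fromℕ-mono 2k<n)
        alg : ∀ n K s → (K + - s + ½ - n) + s + (n - (1ℚ + K)) ≡ 0ℚ - ½
        alg = solve-∀ ringℚ
    n+z : n ℕ.+ z ≡ 2 ℕ.* k
    n+z = ℕₚ.m+[n∸m]≡n n≤2k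
    N+Z : fromℕ n + fromℕ z ≡ K2
    N+Z = trans (sym (fromℕ-+ n z)) (trans (cong fromℕ n+z) K2≡)
    approx : ∀ ε → 0ℚ < ε → ∃[ N ] (∀ i → N ℕ.≤ i → √-seq m i ≤ fromℕ z + ε)
    approx ε 0<ε = proj₁ (low ε 0<ε) , λ i N≤i → ≤-by (≤⇒0≤- (proj₂ (low ε 0<ε) i N≤i))
          (trans (cong (λ t → t + - √-seq m i + ε - fromℕ n) (sym N+Z)) (alg (fromℕ n) (fromℕ z) (√-seq m i) ε))
      where
      alg : ∀ n z s e → n + z + - s + e - n ≡ z + e - s
      alg = solve-∀ ringℚ
    z≤ : z ℕ.≤ suc r
    z≤ = ℕₚ.≮⇒≥ λ r+1<z → ℚₚ.<-irrefl refl (ℚₚ.<-≤-trans lt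
      (subst (fromℕ n + fromℕ (suc (suc r)) ≤_) N+Z (ℚₚ.+-monoʳ-≤ (fromℕ n) (fromℕ-mono r+1<z))))

-- The term at index 3 is 6/4, and later terms fall below it by at most 1/4.
√3-lower : ∀ j → 3 ℕ.≤ j → 5/4ℚ ≤ √-seq 3 j
√3-lower j 3≤j = ≤-by (0≤+ (≤⇒0≤- (√-close 3 3 j)) (≤⇒0≤- 1/j≤1/4)) (alg (√-seq 3 j) (+ 1 / suc j))
  where
  1/j≤1/4 : + 1 / suc j ≤ + 1 / 4
  1/j≤1/4 = ℚₚ.*-cancelʳ-≤-pos (fromℕ (suc j)) {{ℚ.positive (0<fromℕ-suc j)}}
    (subst (_≤ (+ 1 / 4) * fromℕ (suc j)) (sym (/-*-cancel 1 j))
      (ℚₚ.*-monoˡ-≤-nonNeg (+ 1 / 4) (fromℕ-mono {4} {suc j} (ℕ.s≤s 3≤j))))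
  alg : ∀ s t → (s + t - + 6 / 4) + (+ 1 / 4 - t) ≡ s - 5/4ℚ
  alg = solve-∀ ringℚ

quotient-bound : ∀ {s ρ c} → 5/4ℚ ≤ s → fromℕ 8 * s - fromℕ 12 ≤ (fromℕ 2 * s - fromℕ 2) * (ρ + c) →
                 (fromℕ 8 * s - fromℕ 12) * inv (fromℕ 2 * s - fromℕ 2) - c ≤ ρ
quotient-bound {s} {ρ} {c} 5/4≤s h = ℚₚ.*-cancelʳ-≤-pos q {{ℚ.positive 0<q}} (≤-by (≤⇒0≤- h)
  (trans (cong (λ z → q * (ρ + c) - z) (sym p≡)) (alg p q (inv q) ρ c)))
  where
  p = fromℕ 8 * s - fromℕ 12
  q = fromℕ 2 * s - fromℕ 2
  0<q : 0ℚ < q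
  0<q = ℚₚ.<-≤-trans (ℚₚ.positive⁻¹ (+ 1 / 2)) (≤-by (0≤* (0≤fromℕ 2) (≤⇒0≤- 5/4≤s)) (alg₁ s))
    where
    alg₁ : ∀ s → fromℕ 2 * (s - 5/4ℚ) ≡ fromℕ 2 * s - fromℕ 2 - + 1 / 2
    alg₁ = solve-∀ ringℚ
  p≡ : p * (inv q * q) ≡ p
  p≡ = trans (cong (λ z → p * z) (inv-cancel (λ q≡0 → ℚₚ.<-irrefl (sym q≡0) 0<q))) (ℚₚ.*-identityʳ p)
  alg : ∀ p q i ρ c → q * (ρ + c) - p * (i * q) ≡ ρ * q - (p * i - c) * q
  alg = solve-∀ ringℚ

-- The ratio of the minima

isqrt-3k²-2k : ∀ k → let r = isqrt ((3 ℕ.* (k ℕ.* k) ℕ.∸ 2 ℕ.* k) ℕ.* 1) in r ℕ.* r ℕ.≤ 3 ℕ.* (k ℕ.* k)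
isqrt-3k²-2k k = ℕₚ.≤-trans (isqrt-lower (m ℕ.* 1))
  (ℕₚ.≤-trans (ℕₚ.≤-reflexive (ℕₚ.*-identityʳ m)) (ℕₚ.m∸n≤m (3 ℕ.* (k ℕ.* k)) (2 ℕ.* k)))
  where m = 3 ℕ.* (k ℕ.* k) ℕ.∸ 2 ℕ.* k

isqrt-3k²-2k<2k : ∀ {k} → 1 ℕ.≤ k → let r = isqrt ((3 ℕ.* (k ℕ.* k) ℕ.∸ 2 ℕ.* k) ℕ.* 1) in r ℕ.< 2 ℕ.* k
isqrt-3k²-2k<2k {k} 1≤k = ℕₚ.≰⇒> λ 2k≤r → ℕₚ.<⇒≱ (ℕₚ.m<m+n (3 ℕ.* (k ℕ.* k)) {k ℕ.* k} (ℕₚ.*-mono-≤ 1≤k 1≤k))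
  (ℕₚ.≤-trans (ℕₚ.≤-reflexive (square k)) (ℕₚ.≤-trans (ℕₚ.*-mono-≤ 2k≤r 2k≤r) (isqrt-3k²-2k k)))
  where
  square : ∀ k → 3 ℕ.* (k ℕ.* k) ℕ.+ k ℕ.* k ≡ 2 ℕ.* k ℕ.* (2 ℕ.* k)
  square = solveℕ-∀

-- The premises leave n = 0 and n = 1. The only cell is a terminal, so `φ` is evaluated at 0, which
-- does not exceed the threshold 1 - n.
cost-1×1 : ∀ {n z} → n ℕ.+ z ≡ 2 → 1 ℕ.≤ z ℕ.* z → (A : Assignment 1) → cost (fromℤ (+ 2 ℤ.* + n)) A ≡ 0ℚ
cost-1×1 {0} _ _ A = cong (λ b → f {1} (fromℤ (+ 0)) (λ _ → b) + 0ℚ) (terminals A zero)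
cost-1×1 {1} _ _ A = cong (λ b → f {1} (fromℤ (+ 2)) (λ _ → b) + 0ℚ) (terminals A zero)
cost-1×1 {suc (suc n)} {zero}  _  () A
cost-1×1 {suc (suc n)} {suc z} eq _  A = contradiction (trans (sym (ℕₚ.+-suc n z)) (ℕₚ.suc-injective (ℕₚ.suc-injective eq))) λ ()

module _ {k n z : ℕ} (2≤k : 2 ℕ.≤ k) (n+z : n ℕ.+ z ≡ 2 ℕ.* k) where

  private
    m = 3 ℕ.* (k ℕ.* k) ℕ.∸ 2 ℕ.* k
    r = isqrt (m ℕ.* 1)
    K = fromℕ k
    H = fromℕ n
    Z = fromℕ z
    γ = fromℤ (+ 2 ℤ.* + n)
    γ≡ : γ ≡ fromℕ 2 * H
    γ≡ = fromℤ-* (+ 2) (+ n)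

  module _ (m≤z² : m ℕ.≤ z ℕ.* z) (z≤r+1 : z ℕ.≤ suc r) {minSym minAll : ℚ}
           (isSym : IsMinimum {Assignment k} Symmetric (cost γ) minSym)
           (isAll : IsMinimum {Assignment k} (λ _ → ⊤) (cost γ) minAll) where

    private
      2≤K : fromℕ 2 ≤ K
      2≤K = fromℕ-mono {2} {k} 2≤k
      H+Z : H + Z ≡ fromℕ 2 * K
      H+Z = trans (sym (fromℕ-+ n z)) (trans (cong fromℕ n+z) (fromℕ-* 2 k))
      3K² : fromℕ (3 ℕ.* (k ℕ.* k)) ≡ fromℕ 3 * (K * K)
      3K² = trans (fromℕ-* 3 (k ℕ.* k)) (cong (λ t → fromℕ 3 * t) (fromℕ-* k k))
      -- Moving 2k to the other side is valid even for truncated subtraction.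
      Z² : fromℕ 3 * (K * K) ≤ Z * Z + fromℕ 2 * K
      Z² = subst₂ _≤_ 3K² (trans (fromℕ-+ (z ℕ.* z) (2 ℕ.* k)) (cong₂ _+_ (fromℕ-* z z) (fromℕ-* 2 k)))
        (fromℕ-mono {3 ℕ.* (k ℕ.* k)} {z ℕ.* z ℕ.+ 2 ℕ.* k} (ℕₚ.≤-trans (ℕₚ.m≤n+m∸n (3 ℕ.* (k ℕ.* k)) (2 ℕ.* k))
          (ℕₚ.≤-trans (ℕₚ.+-monoʳ-≤ (2 ℕ.* k) m≤z²) (ℕₚ.≤-reflexive (ℕₚ.+-comm (2 ℕ.* k) (z ℕ.* z))))))
      r² : fromℕ r * fromℕ r ≤ fromℕ 3 * (K * K)
      r² = subst₂ _≤_ (fromℕ-* r r) 3K² (fromℕ-mono {r ℕ.* r} {3 ℕ.* (k ℕ.* k)} (isqrt-3k²-2k k))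
      Z≤r+1 : Z ≤ fromℕ r + 1ℚ
      Z≤r+1 = subst (Z ≤_) (trans (fromℕ-+ 1 r) (ℚₚ.+-comm 1ℚ (fromℕ r))) (fromℕ-mono {z} {suc r} z≤r+1)
      n+n≤k : n ℕ.+ n ℕ.≤ k
      n+n≤k = ℕₚ.≮⇒≥ λ k<n+n → half-bound {H} {K} {Z} 2≤K H+Z (0≤fromℕ z) Z²
        (subst₂ _≤_ (trans (fromℕ-+ 1 k) (ℚₚ.+-comm 1ℚ K)) (fromℕ-+ n n) (fromℕ-mono {suc k} {n ℕ.+ n} k<n+n))
      2H≤K : H + H ≤ K
      2H≤K = subst (_≤ K) (fromℕ-+ n n) (fromℕ-mono {n ℕ.+ n} {k} n+n≤k)

      ρ D : ℚ
      ρ = minSym ÷₀ minAll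
      D = K * ((K - H) + (K - H))
      A B : Assignment k
      A = proj₁ (proj₁ isSym)
      B = proj₁ (proj₁ isAll)
      A-sym : Symmetric A
      A-sym = proj₁ (proj₂ (proj₁ isSym))
      costA : cost γ A ≡ minSym
      costA = proj₂ (proj₂ (proj₁ isSym))
      0<minAll : 0ℚ < minAll
      0<minAll = subst (0ℚ <_) (proj₂ (proj₂ (proj₁ isAll))) (cost-positive {k} {γ} {H} 2≤k γ≡ 2H≤K B)
      minAll≤D : minAll ≤ D
      minAll≤D = ℚₚ.≤-trans (proj₂ isAll (rowAssignment k) tt) (rowAssignment-cost {k} {γ} {H} γ≡)
      ρ*minAll : ρ * minAll ≡ minSym
      ρ*minAll = trans (ℚₚ.*-assoc minSym (inv minAll) minAll)
        (trans (cong (λ t → minSym * t) (inv-cancel (λ eq → ℚₚ.<-irrefl (sym eq) 0<minAll))) (ℚₚ.*-identityʳ minSym))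
      0≤minSym : 0ℚ ≤ minSym
      0≤minSym = ℚₚ.≤-trans (ℚₚ.<⇒≤ 0<minAll) (subst (minAll ≤_) costA (proj₂ isAll A tt))
      0≤ρ : 0ℚ ≤ ρ
      0≤ρ = ℚₚ.*-cancelʳ-≤-pos minAll {{ℚ.positive 0<minAll}}
        (subst₂ _≤_ (sym (ℚₚ.*-zeroˡ minAll)) (sym ρ*minAll) 0≤minSym)
      minSym≤ρD : minSym ≤ ρ * D
      minSym≤ρD = subst (_≤ ρ * D) ρ*minAll (ℚₚ.*-monoˡ-≤-nonNeg ρ {{ℚ.nonNegative 0≤ρ}} minAll≤D)

    minimum-ratio : ∀ {s κ} → 5/4ℚ ≤ s → s * s ≤ fromℕ 3 → κ * K ≡ 1ℚ →
      fromℕ 8 * s - fromℕ 12 ≤ (fromℕ 2 * s - fromℕ 2) * (ρ + fromℕ 38 * κ)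
    minimum-ratio {s} {κ} 5/4≤s s²≤3 κK≡1 =
      [ (λ h → conclude {M₁} h (ratio-slack₁ {s} {K} {H} {Z} {fromℕ r} 5/4≤s s²≤3 2≤K H+Z 2H≤K (0≤fromℕ z) Z² Z≤r+1 (0≤fromℕ r) r²))
      , (λ h → conclude {M₂} h (ratio-slack₂ {s} {K} {H} {Z} {fromℕ r} 5/4≤s s²≤3 2≤K H+Z 2H≤K (0≤fromℕ z) Z² Z≤r+1 (0≤fromℕ r) r²))
      ]′ (symmetric-cost {k} {γ} {H} γ≡ (0≤fromℕ n) 2H≤K A A-sym)
      where
      M₁ = fromℕ 2 * K * H + fromℕ 3 * K
      M₂ = (K - H) * (K - H) + fromℕ 3 * K
      conclude : ∀ {M} → D + D ≤ cost γ A + (M + M) →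
        (fromℕ 8 * s - fromℕ 12) * (K * (K - H)) + (s - 1ℚ) * (M + M)
          ≤ (s - 1ℚ) * (fromℕ 76 * (K - H) + fromℕ 4 * (K * (K - H))) →
        fromℕ 8 * s - fromℕ 12 ≤ (fromℕ 2 * s - fromℕ 2) * (ρ + fromℕ 38 * κ)
      conclude {M} h = ratio-bound {s} {K} {H} {Z} {fromℕ r} 5/4≤s s²≤3 2≤K H+Z 2H≤K (0≤fromℕ z) Z² Z≤r+1 (0≤fromℕ r) r²
        {minSym} {ρ} {κ} {M} κK≡1 (subst (λ t → D + D ≤ t + (M + M)) costA h) minSym≤ρD

floor-ratio : ∀ {k} → 2 ℕ.≤ k → ∀ h →
    IsFloor (ιℕ 2 *ᴿ ιℕ k -ᴿ √ (3 ℕ.* (k ℕ.* k) ℕ.∸ 2 ℕ.* k)) h →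
    let γ = fromℤ (+ 2 ℤ.* h) in
    ∀ {minSym minAll : ℚ} →
    IsMinimum {Assignment k} Symmetric (cost γ) minSym →
    IsMinimum {Assignment k} (λ _ → ⊤) (cost γ) minAll →
    ∀ {s κ} → 5/4ℚ ≤ s → s * s ≤ fromℕ 3 → κ * fromℕ k ≡ 1ℚ →
    fromℕ 8 * s - fromℕ 12 ≤ (fromℕ 2 * s - fromℕ 2) * (minSym ÷₀ minAll + fromℕ 38 * κ)
floor-ratio {k} 2≤k h fl {minSym} {minAll} isSym isAll {s} {κ} 5/4≤s s²≤3 κK≡1 =
  conclude (floor-√ k m h (isqrt-3k²-2k<2k (ℕₚ.≤-trans (ℕ.s≤s ℕ.z≤n) 2≤k)) fl)
  where
  m = 3 ℕ.* (k ℕ.* k) ℕ.∸ 2 ℕ.* k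
  conclude : ∃[ n ] ∃[ z ] (h ≡ + n × n ℕ.+ z ≡ 2 ℕ.* k × m ℕ.≤ z ℕ.* z × z ℕ.≤ suc (isqrt (m ℕ.* 1))) →
    fromℕ 8 * s - fromℕ 12 ≤ (fromℕ 2 * s - fromℕ 2) * (minSym ÷₀ minAll + fromℕ 38 * κ)
  conclude (n , z , h≡n , n+z , m≤z² , z≤r+1) = minimum-ratio {k} {n} {z} 2≤k n+z m≤z² z≤r+1 {minSym} {minAll}
    (subst (λ t → IsMinimum {Assignment k} Symmetric (cost (fromℤ (+ 2 ℤ.* t))) minSym) h≡n isSym)
    (subst (λ t → IsMinimum {Assignment k} (λ _ → ⊤) (cost (fromℤ (+ 2 ℤ.* t))) minAll) h≡n isAll)
    {s} {κ} 5/4≤s s²≤3 κK≡1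

minimum-ratio-bound : ∀ (k : ℕ) .{{_ : ℕ.NonZero k}} (h : ℤ) →
    IsFloor (ιℕ 2 *ᴿ ιℕ k -ᴿ √ (3 ℕ.* (k ℕ.* k) ℕ.∸ 2 ℕ.* k)) h →
    let γ = fromℤ (+ 2 ℤ.* h) in
    ∀ (minSym minAll : ℚ) →
    IsMinimum {Assignment k} Symmetric (cost γ) minSym →
    IsMinimum {Assignment k} (λ _ → ⊤) (cost γ) minAll →
    ∀ {s} → 5/4ℚ ≤ s → s * s ≤ fromℕ 3 →
    fromℕ 8 * s - fromℕ 12 ≤ (fromℕ 2 * s - fromℕ 2) * (minSym ÷₀ minAll + fromℕ 38 * (+ 1 / k))
minimum-ratio-bound zero _ _ _ _ _ _ _ _ = contradiction refl (ℕ.≢-nonZero⁻¹ 0)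
-- For k = 1 the symmetric minimum vanishes and the quotient is 0, but the error term 38 alone
-- exceeds the claimed ratio.
minimum-ratio-bound (suc zero) h fl minSym minAll ((A , _ , costA) , _) _ {s} 5/4≤s _ =
  conclude (floor-√ 1 1 h (isqrt-3k²-2k<2k {1} (ℕ.s≤s ℕ.z≤n)) fl)
  where
  alg : ∀ s → fromℕ 68 * (s - 5/4ℚ) + fromℕ 21
              ≡ (fromℕ 2 * s - fromℕ 2) * (0ℚ + fromℕ 38 * 1ℚ) - (fromℕ 8 * s - fromℕ 12)
  alg = solve-∀ ringℚ
  ρ≡0 : cost (fromℤ (+ 2 ℤ.* h)) A ≡ 0ℚ → minSym ÷₀ minAll ≡ 0ℚ
  ρ≡0 cost≡0 = trans (cong (_÷₀ minAll) (trans (sym costA) cost≡0)) (ℚₚ.*-zeroˡ (inv minAll))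
  conclude : ∃[ n ] ∃[ z ] (h ≡ + n × n ℕ.+ z ≡ 2 × 1 ℕ.≤ z ℕ.* z × z ℕ.≤ suc (isqrt 1)) →
    fromℕ 8 * s - fromℕ 12 ≤ (fromℕ 2 * s - fromℕ 2) * (minSym ÷₀ minAll + fromℕ 38 * 1ℚ)
  conclude (n , z , h≡n , n+z , 1≤z² , _) = subst
    (λ t → fromℕ 8 * s - fromℕ 12 ≤ (fromℕ 2 * s - fromℕ 2) * (t + fromℕ 38 * 1ℚ))
    (sym (ρ≡0 (trans (cong (λ t → cost (fromℤ (+ 2 ℤ.* t)) A) h≡n) (cost-1×1 {n} {z} n+z 1≤z² A))))
    (≤-by (0≤+ (0≤* (0≤fromℕ 68) (≤⇒0≤- 5/4≤s)) (0≤fromℕ 21)) (alg s))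
minimum-ratio-bound (suc (suc k)) h fl minSym minAll isSym isAll {s} 5/4≤s s²≤3 =
  floor-ratio (ℕ.s≤s (ℕ.s≤s ℕ.z≤n)) h fl isSym isAll {s} {+ 1 / suc (suc k)} 5/4≤s s²≤3 (/-*-cancel 1 (suc k))

theorem9 : ∃[ C ] (∀ (k : ℕ) .{{_ : ℕ.NonZero k}} (h : ℤ) →
    IsFloor (ιℕ 2 *ᴿ ιℕ k -ᴿ √ (3 ℕ.* (k ℕ.* k) ℕ.∸ 2 ℕ.* k)) h →
    let γ = fromℤ (+ 2 ℤ.* h) in
    ∀ (minSym minAll : ℚ) →
    IsMinimum {Assignment k} Symmetric (cost γ) minSym →
    IsMinimum {Assignment k} (λ _ → ⊤) (cost γ) minAll →
    (ιℕ 8 *ᴿ √ 3 -ᴿ ιℕ 12) /ᴿ (ιℕ 2 *ᴿ √ 3 -ᴿ ιℕ 2) -ᴿ ι (C ℚ.* (+ 1 / k))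
    ≤ᴿ ι (minSym ÷₀ minAll))
-- The constant is half of the 76 in the slack estimates. From index 3 on, where `√-seq 3` is at
-- least 5/4, every term satisfies the inequality even without `ε`.
theorem9 = fromℕ 38 , λ k h fl minSym minAll isSym isAll ε 0<ε → 3 , λ j 3≤j →
  ℚₚ.≤-trans
    (quotient-bound (√3-lower j 3≤j)
      (minimum-ratio-bound k h fl minSym minAll isSym isAll (√3-lower j 3≤j) (√-seq-square 3 j)))
    (≤-by (ℚₚ.<⇒≤ 0<ε) (alg (minSym ÷₀ minAll) ε))
  where
  alg : ∀ ρ e → e ≡ ρ + e - ρ
  alg = solve-∀ ringℚ
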